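{- For each $n\geq 1$, let $Q_n$ denote the cograph of maximum global mean among all connected cographs of order $n$. If $G$ is a disconnected cograph of order $n \geq 2$, then $M_{G} \leq M_{K_{1} \cup Q_{n-1}}$.
   Context: All graphs are finite and simple with at least one vertex; the order of a graph is its number of vertices. A graph is a cograph if it contains no induced path on $4$ vertices. For a graph $G$ of order $n$, let $a_k(G)$ be the number of $k$-element vertex subsets of $G$ that induce a connected subgraph (single vertices count as connected), and let $\Phi_G(x)=\sum_{k=1}^n a_k(G)x^k$. The global mean of $G$ is $M_G=\Phi_G'(1)/\Phi_G(1)$. $G_1\cup G_2$ denotes the disjoint union of graphs, and $K_{s,t}$ the complete bipartite graph with parts of sizes $s$ and $t$. The graphs $Q_n$ are explicitly: $Q_1=K_1$, $Q_2=K_2$, $Q_3=K_3$, $Q_4=K_{2,2}$, $Q_5=K_{2,3}$, $Q_6=K_{2,4}$, and $Q_n=K_{1,n-1}$ for $n\geq 7$. -}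

module Defs where

open import Data.Fin using (Fin; toℕ; splitAt; zero; suc)
import Data.Fin.Properties as Fin
open import Data.Fin.Subset using (Subset; inside; outside; _∈_; Nonempty; ∣_∣; ⁅_⁆; ⊤)
open import Data.Fin.Subset.Properties using (_∈?_; nonempty?; x∈⁅x⁆; x∈⁅y⁆⇒x≡y; ∣⁅x⁆∣≡1)
open import Data.Integer using (+_)
open import Data.List using (List; []; _∷_; [_]; _++_; map; filter; length; upTo; drop; zipWith; allFin)
open import Data.List.Membership.Propositional using () renaming (_∈_ to _∈ˡ_)
open import Data.List.Membership.Propositional.Properties using (∈-map⁺; ∈-++⁺ˡ; ∈-++⁺ʳ; ∈-filter⁺; ∈-allFin)
open import Data.List.Relation.Unary.Any using (here; there)
open import Data.Nat using (ℕ; zero; suc; pred; _+_; _*_; _≟_; NonZero)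
open import Data.Product using (_×_; _,_)
open import Data.Rational using (ℚ; _/_) renaming (_≤_ to _≤ℚ_)
open import Data.Sum using (_⊎_; inj₁; inj₂; swap)
open import Data.Sum.Relation.Binary.Pointwise using (Pointwise; ⊎-decidable; ⊎-symmetric; ⊎-irreflexive; ≡⇒Pointwise-≡)
import Data.Vec as Vec
open import Function using (_∘_; _⇔_)
open import Function.Definitions using (Injective)
open import Level using (0ℓ)
open import Relation.Binary using (Rel; Decidable; Symmetric; Irreflexive)
open import Relation.Binary.Construct.Closure.ReflexiveTransitive using (Star; ε; _◅_; _◅◅_)
open import Relation.Binary.PropositionalEquality using (_≡_; _≢_; refl; sym; trans; cong; subst)
open import Relation.Nullary using (¬_; Dec)
open import Relation.Nullary.Decidable using (map′; ¬?; _×-dec_; _⊎-dec_; _→-dec_)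

private
  variable
    m n : ℕ

record Graph (n : ℕ) : Set₁ where
  infix 4 _~_ _~?_
  field
    _~_      : Rel (Fin n) 0ℓ
    _~?_     : Decidable _~_
    ~-sym    : Symmetric _~_
    ~-irrefl : Irreflexive _≡_ _~_

complete : ∀ n → Graph n
complete n = record
  { _~_      = _≢_
  ; _~?_     = λ x y → ¬? (x Fin.≟ y)
  ; ~-sym    = λ x≢y → x≢y ∘ sym
  ; ~-irrefl = λ x≡y x≢y → x≢y x≡y
  }

K₁ : Graph 1
K₁ = complete 1

path : ∀ n → Graph n
path n = record
  { _~_      = λ x y → suc (toℕ x) ≡ toℕ y ⊎ suc (toℕ y) ≡ toℕ x
  ; _~?_     = λ x y → (suc (toℕ x) ≟ toℕ y) ⊎-dec (suc (toℕ y) ≟ toℕ x)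
  ; ~-sym    = swap
  ; ~-irrefl = λ { {x} refl (inj₁ e) → irr (toℕ x) e ; {x} refl (inj₂ e) → irr (toℕ x) e }
  }
  where
  irr : ∀ k → suc k ≢ k
  irr zero    ()
  irr (suc k) e = irr k (cong pred e)

infixr 6 _∪_

_∪_ : Graph m → Graph n → Graph (m + n)
_∪_ {m} G H = record
  { _~_      = λ x y → Pointwise G._~_ H._~_ (splitAt m x) (splitAt m y)
  ; _~?_     = λ x y → ⊎-decidable G._~?_ H._~?_ (splitAt m x) (splitAt m y)
  ; ~-sym    = ⊎-symmetric G.~-sym H.~-sym
  ; ~-irrefl = λ x≡y → ⊎-irreflexive G.~-irrefl H.~-irrefl
                         (≡⇒Pointwise-≡ (cong (splitAt m) x≡y))
  }
  where
  module G = Graph G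
  module H = Graph H

record InducedEmbedding (H : Graph m) (G : Graph n) : Set where
  private
    module H = Graph H
    module G = Graph G
  field
    to        : Fin m → Fin n
    injective : Injective _≡_ _≡_ to
    adjacency : ∀ x y → (x H.~ y) ⇔ (to x G.~ to y)

Cograph : Graph n → Set
Cograph G = ¬ InducedEmbedding (path 4) G

module _ (G : Graph n) where
  open Graph G

  StepIn : Subset n → Rel (Fin n) 0ℓ
  StepIn S x y = x ∈ S × y ∈ S × x ~ y

  -- The subgraph induced by S is connected: S is nonempty and any two of its
  -- vertices are joined by a walk all of whose vertices lie in S.
  InducesConnected : Subset n → Set
  InducesConnected S =
    Nonempty S × (∀ x y → x ∈ S → y ∈ S → Star (StepIn S) x y)

  Connected : Set
  Connected = InducesConnected ⊤

  Disconnected : Set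
  Disconnected = ¬ Connected

-- Reachability in a finite relation is decidable: Via vs x y says that y can be
-- reached from x through intermediate points among vs (Warshall's recursion).
module Reachability (R : Rel (Fin n) 0ℓ) (R? : Decidable R) where

  Via : List (Fin n) → Rel (Fin n) 0ℓ
  Via []       x y = x ≡ y ⊎ R x y
  Via (v ∷ vs) x y = Via vs x y ⊎ (Via vs x v × Via vs v y)

  via? : ∀ vs → Decidable (Via vs)
  via? []       x y = (x Fin.≟ y) ⊎-dec R? x y
  via? (v ∷ vs) x y = via? vs x y ⊎-dec (via? vs x v ×-dec via? vs v y)

  via-sound : ∀ vs {x y} → Via vs x y → Star R x y
  via-sound []       (inj₁ refl)    = ε
  via-sound []       (inj₂ r)       = r ◅ ε
  via-sound (v ∷ vs) (inj₁ p)       = via-sound vs p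
  via-sound (v ∷ vs) (inj₂ (p , q)) = via-sound vs p ◅◅ via-sound vs q

  via-lift : ∀ vs {x y} → x ≡ y ⊎ R x y → Via vs x y
  via-lift []       p = p
  via-lift (v ∷ vs) p = inj₁ (via-lift vs p)

  via-trans : ∀ {vs x v y} → v ∈ˡ vs → Via vs x v → Via vs v y → Via vs x y
  via-trans {w ∷ vs} {x} {v} {y} (here refl) p q = inj₂ (into p , outOf q)
    where
    into : Via (v ∷ vs) x v → Via vs x v
    into (inj₁ a)       = a
    into (inj₂ (a , _)) = a
    outOf : Via (v ∷ vs) v y → Via vs v y
    outOf (inj₁ b)       = b
    outOf (inj₂ (_ , b)) = b
  via-trans (there i) (inj₁ a)       (inj₁ b)       = inj₁ (via-trans i a b)
  via-trans (there i) (inj₁ a)       (inj₂ (b , c)) = inj₂ (via-trans i a b , c)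
  via-trans (there i) (inj₂ (a , b)) (inj₁ c)       = inj₂ (a , via-trans i b c)
  via-trans (there i) (inj₂ (a , b)) (inj₂ (c , d)) = inj₂ (a , d)

  via-complete : ∀ {x y} → Star R x y → Via (allFin n) x y
  via-complete ε              = via-lift (allFin n) (inj₁ refl)
  via-complete (_◅_ {j = z} r rs) =
    via-trans (∈-allFin z) (via-lift (allFin n) (inj₂ r)) (via-complete rs)

  star? : Decidable (Star R)
  star? x y = map′ (via-sound (allFin n)) via-complete (via? (allFin n) x y)

inducesConnected? : (G : Graph n) (S : Subset n) → Dec (InducesConnected G S)
inducesConnected? G S = nonempty? S ×-dec
  Fin.all? λ x → Fin.all? λ y → (x ∈? S) →-dec ((y ∈? S) →-dec star? x y)
  where
  open Graph G
  open Reachability (StepIn G S)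
    (λ x y → (x ∈? S) ×-dec ((y ∈? S) ×-dec (x ~? y)))

subsets : ∀ n → List (Subset n)
subsets zero    = [ Vec.[] ]
subsets (suc n) = map (inside Vec.∷_) (subsets n) ++ map (outside Vec.∷_) (subsets n)

a : ℕ → Graph n → ℕ
a {n} k G = length (filter (λ S → (∣ S ∣ ≟ k) ×-dec inducesConnected? G S) (subsets n))

-- Polynomials over ℕ as lists of coefficients, constant term first.
Poly : Set
Poly = List ℕ

eval : Poly → ℕ → ℕ
eval []      x = 0
eval (c ∷ p) x = c + x * eval p x

derivative : Poly → Poly
derivative p = drop 1 (zipWith _*_ (upTo (length p)) p)

Φ : Graph n → Poly
Φ {n} G = 0 ∷ map (λ i → a (suc i) G) (upTo n)

∈-subsets : (S : Subset n) → S ∈ˡ subsets n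
∈-subsets Vec.[]                     = here refl
∈-subsets (inside Vec.∷ S)           = ∈-++⁺ˡ (∈-map⁺ (inside Vec.∷_) (∈-subsets S))
∈-subsets {suc n} (outside Vec.∷ S)  =
  ∈-++⁺ʳ (map (inside Vec.∷_) (subsets n)) (∈-map⁺ (outside Vec.∷_) (∈-subsets S))

singleton-connected : (G : Graph n) (x : Fin n) → InducesConnected G ⁅ x ⁆
singleton-connected G x = (x , x∈⁅x⁆ x) , λ y z y∈ z∈ →
  subst (Star (StepIn G ⁅ x ⁆) y) (trans (x∈⁅y⁆⇒x≡y x y∈) (sym (x∈⁅y⁆⇒x≡y x z∈))) ε

Φ[1]-nonZero : (G : Graph n) .{{_ : NonZero n}} → NonZero (eval (Φ G) 1)
Φ[1]-nonZero {suc n} G = positive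
  (∈-filter⁺ (λ S → (∣ S ∣ ≟ 1) ×-dec inducesConnected? G S)
    (∈-subsets ⁅ zero ⁆) (∣⁅x⁆∣≡1 {suc n} zero , singleton-connected G zero))
  where
  positive : ∀ {A : Set} {x : A} {xs : List A} {r} →
             x ∈ˡ xs → NonZero (length xs + r + 0)
  positive {xs = _ ∷ _} _ = _

globalMean : (G : Graph n) .{{_ : NonZero n}} → ℚ
globalMean G = _/_ (+ eval (derivative (Φ G)) 1) (eval (Φ G) 1) {{Φ[1]-nonZero G}}

record IsMaxMeanConnectedCograph (Q : Graph n) .{{_ : NonZero n}} : Set₁ where
  field
    connected : Connected Q
    cograph   : Cograph Q
    maximum   : (H : Graph n) → Connected H → Cograph H →
                globalMean H ≤ℚ globalMean Q

{-# OPTIONS --safe #-}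
-- A cograph with at least two vertices is a disjoint union or join of smaller ones (Seinsche), so
-- its numbers of vertices, of connected sets and their total size are computed along a cotree:
-- in a join, the new connected sets are exactly those meeting both sides.  Write h for the order, S
-- for the number of connected sets and W for the sum of their sizes.  The deficit
-- δ = (h + 2) S - 2 W obeys a recursion with nonnegative terms, and graphs of the same order are
-- ordered by their mean as by -δ / S.
--
-- Among the connected cographs of order m the star has the fewest connected sets.  As Q has at
-- least the mean of the star and at least as many connected sets, the mean of K₁ ∪ Q is at least
-- that of K₁ ∪ star.  For m ≥ 7 every disconnected cograph of order m + 1 has mean at most that of
-- K₁ ∪ star: if both parts have at least two vertices then δ ≥ 3 S, which suffices; otherwise the
-- graph is K₁ ∪ H, and one looks at the last few operations building H.  For m ≤ 6 the finitely
-- many triples (h, S, W) are enumerated; the mean of the explicit Qₘ singles out its triple among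
-- those of order m.
module Submission where

open import Defs
open import Data.Bool using (Bool; true; false; if_then_else_; _∧_; not)
open import Data.Bool.Properties using (∧-zeroʳ; ∧-identityʳ; ¬-not; not-involutive)
  renaming (_≟_ to _≟ᵇ_)
open import Data.Empty using (⊥-elim) renaming (⊥ to False)
open import Data.Fin using (Fin; zero; suc)
open import Data.Fin.Patterns using (0F; 1F; 2F; 3F)
import Data.Fin.Properties as Fin
open import Data.Fin.Subset
  using (Subset; inside; outside; _∈_; _∉_; _⊆_; Nonempty; ∣_∣; ⁅_⁆; ⊤; ⊥; ∁; _-_)
  renaming (_∪_ to _∪ˢ_)
open import Data.Fin.Subset.Properties
open import Data.Integer using (+≤+)
import Data.Integer as ℤ
import Data.Integer.Properties as ℤ
open import Data.List
  using (List; []; _∷_; _++_; map; filter; deduplicate; cartesianProduct; cartesianProductWith;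
         length; upTo; applyUpTo; zipWith)
open import Data.List.Membership.Propositional using () renaming (_∈_ to _∈ˡ_)
open import Data.List.Membership.Propositional.Properties
  using (∈-++⁺ˡ; ∈-++⁺ʳ; ∈-filter⁺; ∈-deduplicate⁺; ∈-cartesianProduct⁺; ∈-cartesianProductWith⁺)
open import Data.List.Properties using (map-++; map-∘)
import Data.List.Relation.Unary.All as All
open import Data.List.Relation.Unary.Any using (here; there)
open import Data.Nat
  using (ℕ; zero; suc; _+_; _*_; _∸_; _≤_; _<_; z≤n; s≤s; _≡ᵇ_; _≟_; _≤?_; NonZero; >-nonZero)
open import Data.Nat.ListAction using (sum)
open import Data.Nat.ListAction.Properties using (sum-++)
open import Data.Nat.Properties hiding (_≟_; _≤?_)
open import Data.Nat.Tactic.RingSolver using (solve-∀)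
open import Data.Product using (∃; ∃-syntax; _×_; _,_; proj₁; proj₂)
open import Data.Product.Properties using (≡-dec)
open import Data.Rational using (_/_) renaming (_≤_ to _≤ℚ_)
import Data.Rational.Properties as ℚ
open import Data.Rational.Unnormalised using (mkℚᵘ; *≤*)
import Data.Rational.Unnormalised.Properties as ℚᵘ
open import Data.Sum using (_⊎_; inj₁; inj₂)
open import Data.Sum.Relation.Binary.Pointwise using (inj₁; inj₂)
open import Data.Vec using ([]; _∷_; here; there; lookup)
open import Data.Vec.Properties using ([]=⇒lookup; lookup⇒[]=)
open import Function using (_∘_; id; const; _⇔_; mk⇔; Equivalence)
open import Level using (0ℓ)
open import Relation.Binary using (DecidableEquality)
open import Relation.Binary.Construct.Closure.ReflexiveTransitive using (Star; ε; _◅_; _◅◅_)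
open import Relation.Binary.PropositionalEquality
  using (_≡_; _≢_; refl; sym; trans; cong; cong₂; subst; subst₂; module ≡-Reasoning)
open import Relation.Nullary using (¬_; Dec; yes; no; does; contradiction)
open import Relation.Nullary.Decidable
  using (_×-dec_; _⊎-dec_; _→-dec_; ¬?; dec-true; dec-false; from-yes; from-no; decidable-stable)
open import Relation.Unary using (Pred; Decidable)

-- An isolated vertex turns (S, W) into (S + 1, W + 1), so an inequality between means W / S alone
-- does not survive it. The number of connected sets of Q has to be controlled too: from below by
-- the star at large orders, through the whole triple at small ones.
--
-- The factor 3 arises as follows. Every cograph satisfies δ ≥ S, that is, its mean is at most (h +
-- 1) / 2. For a disjoint union, δ(A ∪ B) = δ(A) + δ(B) + |B| S(A) + |A| S(B), which is at least 3 S
-- when both parts have two vertices. For K₁ ∪ star with j leaves, δ = 2 S + j (j + 1), and j (j +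
-- 1) ≤ S for all j ≥ 6, because S grows like 2 ^ j. With an isolated vertex the union formula gives
-- only 2 S from these estimates, so the remaining term j (j + 1) has to be found inside H. Equality
-- occurs when H is the star; this is where the sharper constants are needed.

private
  variable
    m n : ℕ

-- Numerical invariants of cotrees

infixl 6 _⊕_
infixl 7 _⊗_

data Cotree : Set where
  leaf    : Cotree
  _⊕_ _⊗_ : Cotree → Cotree → Cotree

order : Cotree → ℕ
order leaf    = 1
order (a ⊕ b) = order a + order b
order (a ⊗ b) = order a + order b

-- 2 ^ n - 1, the number of nonempty subsets of an n-set
nonempties : ℕ → ℕ
nonempties zero    = 0
nonempties (suc n) = suc (nonempties n + nonempties n)

-- n * 2 ^ (n - 1), the sum of the sizes of all subsets of an n-set
totalSize : ℕ → ℕ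
totalSize zero    = 0
totalSize (suc n) = (totalSize n + suc (nonempties n)) + totalSize n

-- 2 ^ n - 1 - n
excess : ℕ → ℕ
excess zero    = 0
excess (suc n) = n + (excess n + excess n)

-- The number of connected sets with at least two vertices and the sum of their sizes, for a graph
-- with the given cotree (⊕ is the disjoint union, ⊗ the join).
big bigSize : Cotree → ℕ
big leaf    = 0
big (a ⊕ b) = big a + big b
big (a ⊗ b) = nonempties (order a) * nonempties (order b) + (big a + big b)
bigSize leaf    = 0
bigSize (a ⊕ b) = bigSize a + bigSize b
bigSize (a ⊗ b) =
  (totalSize (order a) * nonempties (order b) + nonempties (order a) * totalSize (order b))
  + (bigSize a + bigSize b)

#conn sizeSum : Cotree → ℕ
#conn a   = order a + big a
sizeSum a = order a + bigSize a

-- (2 + order a) * big a - 2 * bigSize a, by a recursion without subtraction.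
defect : Cotree → ℕ
defect leaf    = 0
defect (a ⊕ b) = (defect a + defect b) + (order b * big a + order a * big b)
defect (a ⊗ b) =
  (nonempties (order a) * excess (order b) + nonempties (order b) * excess (order a))
  + ((defect a + defect b) + (order b * big a + order a * big b))

-- (2 + order a) * #conn a - 2 * sizeSum a: the mean sizeSum a / #conn a is 1 + order a / 2 minus
-- half of deficit a / #conn a.
deficit : Cotree → ℕ
deficit a = order a * order a + defect a

≤-by : ∀ {m n} k → m + k ≡ n → m ≤ n
≤-by {m} k refl = m≤m+n m k

nonempties≡ : ∀ n → nonempties n ≡ n + excess n
nonempties≡ zero    = refl
nonempties≡ (suc n) rewrite nonempties≡ n = cong suc (alg n (excess n))
  where
  alg : ∀ n e → n + e + (n + e) ≡ n + (n + (e + e))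
  alg = solve-∀

2*totalSize : ∀ n → 2 * totalSize n ≡ n * suc (nonempties n)
2*totalSize zero    = refl
2*totalSize (suc n) = begin
  2 * ((w + suc x) + w)             ≡⟨ alg₁ w x ⟩
  2 * (2 * w) + 2 * suc x           ≡⟨ cong (λ u → 2 * u + 2 * suc x) (2*totalSize n) ⟩
  2 * (n * suc x) + 2 * suc x       ≡⟨ alg₂ n x ⟩
  suc n * suc (suc (x + x))         ∎
  where
  open ≡-Reasoning
  w = totalSize n
  x = nonempties n
  alg₁ : ∀ w x → 2 * ((w + suc x) + w) ≡ 2 * (2 * w) + 2 * suc x
  alg₁ = solve-∀
  alg₂ : ∀ n x → 2 * (n * suc x) + 2 * suc x ≡ suc n * suc (suc (x + x))
  alg₂ = solve-∀

-- The excess terms of `defect` come from the sets meeting both sides of a join. With x and y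
-- nonempty subsets on sides of orders s and t, twice their total size is s (x + 1) y + t x (y + 1),
-- and (2 + s + t) x y minus this is x (y - t) + y (x - s), where y - t and x - s are the excesses.
bigSize+defect : ∀ a → 2 * bigSize a + defect a ≡ (2 + order a) * big a
bigSize+defect leaf    = refl
bigSize+defect (a ⊕ b) = begin
  2 * (wa + wb) + ((pa + pb) + (t * ra + s * rb))             ≡⟨ alg₁ s t ra rb wa wb pa pb ⟩
  (2 * wa + pa) + (2 * wb + pb) + (t * ra + s * rb)
    ≡⟨ cong₂ (λ u v → u + v + (t * ra + s * rb)) (bigSize+defect a) (bigSize+defect b) ⟩
  (2 + s) * ra + (2 + t) * rb + (t * ra + s * rb)             ≡⟨ alg₂ s t ra rb ⟩
  (2 + (s + t)) * (ra + rb) ∎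
  where
  open ≡-Reasoning
  s = order a ; t = order b ; ra = big a ; rb = big b
  wa = bigSize a ; wb = bigSize b ; pa = defect a ; pb = defect b
  alg₁ : ∀ s t ra rb wa wb pa pb →
    2 * (wa + wb) + ((pa + pb) + (t * ra + s * rb)) ≡
    (2 * wa + pa) + (2 * wb + pb) + (t * ra + s * rb)
  alg₁ = solve-∀
  alg₂ : ∀ s t ra rb →
    (2 + s) * ra + (2 + t) * rb + (t * ra + s * rb) ≡ (2 + (s + t)) * (ra + rb)
  alg₂ = solve-∀
bigSize+defect (a ⊗ b)
  rewrite nonempties≡ (order a) | nonempties≡ (order b) = begin
  2 * ((A * (t + f) + (s + e) * B) + (wa + wb)) +
    (((s + e) * f + (t + f) * e) + ((pa + pb) + (t * ra + s * rb)))
    ≡⟨ alg₁ s t e f A B ra rb wa wb pa pb ⟩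
  (2 * A * (t + f) + (s + e) * (2 * B)) + ((s + e) * f + (t + f) * e)
    + ((2 * wa + pa) + (2 * wb + pb) + (t * ra + s * rb))
    ≡⟨ cong₂ _+_
         (cong₂ (λ u v → (u * (t + f) + (s + e) * v) + ((s + e) * f + (t + f) * e)) A≡ B≡)
         (cong₂ (λ u v → u + v + (t * ra + s * rb)) (bigSize+defect a) (bigSize+defect b)) ⟩
  (s * suc (s + e) * (t + f) + (s + e) * (t * suc (t + f))) + ((s + e) * f + (t + f) * e)
    + ((2 + s) * ra + (2 + t) * rb + (t * ra + s * rb))
    ≡⟨ alg₂ s t e f ra rb ⟩
  (2 + (s + t)) * ((s + e) * (t + f) + (ra + rb)) ∎
  where
  open ≡-Reasoning
  s = order a ; t = order b ; ra = big a ; rb = big b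
  wa = bigSize a ; wb = bigSize b ; pa = defect a ; pb = defect b
  e = excess s ; f = excess t ; A = totalSize s ; B = totalSize t
  A≡ : 2 * A ≡ s * suc (s + e)
  A≡ = trans (2*totalSize s) (cong (λ u → s * suc u) (nonempties≡ s))
  B≡ : 2 * B ≡ t * suc (t + f)
  B≡ = trans (2*totalSize t) (cong (λ u → t * suc u) (nonempties≡ t))
  alg₁ : ∀ s t e f A B ra rb wa wb pa pb →
    2 * ((A * (t + f) + (s + e) * B) + (wa + wb)) +
      (((s + e) * f + (t + f) * e) + ((pa + pb) + (t * ra + s * rb))) ≡
    (2 * A * (t + f) + (s + e) * (2 * B)) + ((s + e) * f + (t + f) * e)
      + ((2 * wa + pa) + (2 * wb + pb) + (t * ra + s * rb))
  alg₁ = solve-∀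
  alg₂ : ∀ s t e f ra rb →
    (s * suc (s + e) * (t + f) + (s + e) * (t * suc (t + f))) + ((s + e) * f + (t + f) * e)
      + ((2 + s) * ra + (2 + t) * rb + (t * ra + s * rb)) ≡
    (2 + (s + t)) * ((s + e) * (t + f) + (ra + rb))
  alg₂ = solve-∀

sizeSum+deficit : ∀ a → 2 * sizeSum a + deficit a ≡ (2 + order a) * #conn a
sizeSum+deficit a = begin
  2 * (h + w) + (h * h + p)           ≡⟨ alg₁ h w p ⟩
  2 * h + h * h + (2 * w + p)         ≡⟨ cong (2 * h + h * h +_) (bigSize+defect a) ⟩
  2 * h + h * h + (2 + h) * r         ≡⟨ alg₂ h r ⟩
  (2 + h) * (h + r) ∎
  where
  open ≡-Reasoning
  h = order a ; w = bigSize a ; p = defect a ; r = big a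
  alg₁ : ∀ h w p → 2 * (h + w) + (h * h + p) ≡ 2 * h + h * h + (2 * w + p)
  alg₁ = solve-∀
  alg₂ : ∀ h r → 2 * h + h * h + (2 + h) * r ≡ (2 + h) * (h + r)
  alg₂ = solve-∀

deficit⇒mean : ∀ a b → order a ≡ order b →
  deficit b * #conn a ≤ deficit a * #conn b → sizeSum a * #conn b ≤ sizeSum b * #conn a
deficit⇒mean a b eq le = *-cancelˡ-≤ 2 (+-cancelʳ-≤ (deficit a * #conn b) _ _ (begin
  2 * (sizeSum a * #conn b) + deficit a * #conn b  ≡⟨ alg (sizeSum a) (deficit a) (#conn b) ⟩
  (2 * sizeSum a + deficit a) * #conn b            ≡⟨ cong (_* #conn b) (sizeSum+deficit a) ⟩
  (2 + order a) * #conn a * #conn b                ≡⟨ cong (λ h → (2 + h) * #conn a * #conn b) eq ⟩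
  (2 + order b) * #conn a * #conn b                ≡⟨ swap (2 + order b) (#conn a) (#conn b) ⟩
  (2 + order b) * #conn b * #conn a                ≡⟨ cong (_* #conn a) (sizeSum+deficit b) ⟨
  (2 * sizeSum b + deficit b) * #conn a            ≡⟨ alg (sizeSum b) (deficit b) (#conn a) ⟨
  2 * (sizeSum b * #conn a) + deficit b * #conn a  ≤⟨ +-monoʳ-≤ (2 * (sizeSum b * #conn a)) le ⟩
  2 * (sizeSum b * #conn a) + deficit a * #conn b  ∎))
  where
  open ≤-Reasoning
  alg : ∀ w d s → 2 * (w * s) + d * s ≡ (2 * w + d) * s
  alg = solve-∀
  swap : ∀ h s t → h * s * t ≡ h * t * s
  swap = solve-∀

-- In a join with x = s + e and y = t + f, the new defect x f + y e equals x y + e f - s t. The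
-- missing s t is paid for by the cross term 2 s t of (s + t) squared.
#conn≤deficit : ∀ a → #conn a ≤ deficit a
#conn≤deficit leaf    = ≤-refl
#conn≤deficit (a ⊕ b) = begin
  (s + t) + (ra + rb)                      ≡⟨ alg₁ s t ra rb ⟩
  (s + ra) + (t + rb)                      ≤⟨ +-mono-≤ (#conn≤deficit a) (#conn≤deficit b) ⟩
  (s * s + pa) + (t * t + pb)
    ≤⟨ ≤-by (2 * (s * t) + (t * ra + s * rb)) (alg₂ s t ra rb pa pb) ⟩
  (s + t) * (s + t) + ((pa + pb) + (t * ra + s * rb)) ∎
  where
  open ≤-Reasoning
  s = order a ; t = order b ; ra = big a ; rb = big b ; pa = defect a ; pb = defect b
  alg₁ : ∀ s t ra rb → (s + t) + (ra + rb) ≡ (s + ra) + (t + rb)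
  alg₁ = solve-∀
  alg₂ : ∀ s t ra rb pa pb →
    (s * s + pa) + (t * t + pb) + (2 * (s * t) + (t * ra + s * rb)) ≡
    (s + t) * (s + t) + ((pa + pb) + (t * ra + s * rb))
  alg₂ = solve-∀
#conn≤deficit (a ⊗ b)
  rewrite nonempties≡ (order a) | nonempties≡ (order b) = begin
  (s + t) + ((s + e) * (t + f) + (ra + rb))          ≡⟨ alg₁ s t e f ra rb ⟩
  (s + ra) + (t + rb) + (s + e) * (t + f)
    ≤⟨ +-monoˡ-≤ _ (+-mono-≤ (#conn≤deficit a) (#conn≤deficit b)) ⟩
  (s * s + pa) + (t * t + pb) + (s + e) * (t + f)
    ≤⟨ ≤-by (s * t + e * f + (t * ra + s * rb)) (alg₂ s t e f ra rb pa pb) ⟩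
  (s + t) * (s + t) + (((s + e) * f + (t + f) * e) + ((pa + pb) + (t * ra + s * rb))) ∎
  where
  open ≤-Reasoning
  s = order a ; t = order b ; ra = big a ; rb = big b ; pa = defect a ; pb = defect b
  e = excess s ; f = excess t
  alg₁ : ∀ s t e f ra rb →
    (s + t) + ((s + e) * (t + f) + (ra + rb)) ≡ (s + ra) + (t + rb) + (s + e) * (t + f)
  alg₁ = solve-∀
  alg₂ : ∀ s t e f ra rb pa pb →
    (s * s + pa) + (t * t + pb) + (s + e) * (t + f) + (s * t + e * f + (t * ra + s * rb)) ≡
    (s + t) * (s + t) + (((s + e) * f + (t + f) * e) + ((pa + pb) + (t * ra + s * rb)))
  alg₂ = solve-∀

-- The comparison from order 8 on

1≤order : ∀ a → 1 ≤ order a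
1≤order leaf    = ≤-refl
1≤order (a ⊕ b) = ≤-trans (1≤order a) (m≤m+n _ _)
1≤order (a ⊗ b) = ≤-trans (1≤order a) (m≤m+n _ _)

leaf-or-2≤order : ∀ a → a ≡ leaf ⊎ 2 ≤ order a
leaf-or-2≤order leaf    = inj₁ refl
leaf-or-2≤order (a ⊕ b) = inj₂ (+-mono-≤ (1≤order a) (1≤order b))
leaf-or-2≤order (a ⊗ b) = inj₂ (+-mono-≤ (1≤order a) (1≤order b))

#conn-⊗-comm : ∀ a b → #conn (a ⊗ b) ≡ #conn (b ⊗ a)
#conn-⊗-comm a b =
  alg (order a) (order b) (nonempties (order a)) (nonempties (order b)) (big a) (big b)
  where
  alg : ∀ s t x y ra rb → (s + t) + (x * y + (ra + rb)) ≡ (t + s) + (y * x + (rb + ra))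
  alg = solve-∀

deficit-⊕-comm : ∀ a b → deficit (a ⊕ b) ≡ deficit (b ⊕ a)
deficit-⊕-comm a b = alg (order a) (order b) (big a) (big b) (defect a) (defect b)
  where
  alg : ∀ s t ra rb pa pb →
    (s + t) * (s + t) + ((pa + pb) + (t * ra + s * rb)) ≡
    (t + s) * (t + s) + ((pb + pa) + (s * rb + t * ra))
  alg = solve-∀

#conn-⊕-comm : ∀ a b → #conn (a ⊕ b) ≡ #conn (b ⊕ a)
#conn-⊕-comm a b = alg (order a) (order b) (big a) (big b)
  where
  alg : ∀ s t ra rb → (s + t) + (ra + rb) ≡ (t + s) + (rb + ra)
  alg = solve-∀

deficit-⊗-comm : ∀ a b → deficit (a ⊗ b) ≡ deficit (b ⊗ a)
deficit-⊗-comm a b =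
  alg (order a) (order b) (nonempties (order a)) (nonempties (order b))
      (excess (order a)) (excess (order b)) (big a) (big b) (defect a) (defect b)
  where
  alg : ∀ s t x y e f ra rb pa pb →
    (s + t) * (s + t) + ((x * f + y * e) + ((pa + pb) + (t * ra + s * rb))) ≡
    (t + s) * (t + s) + ((y * e + x * f) + ((pb + pa) + (s * rb + t * ra)))
  alg = solve-∀

deficit-⊕ : ∀ a b → deficit (a ⊕ b) ≡
  (deficit a + deficit b) + (order b * #conn a + order a * #conn b)
deficit-⊕ a b = alg (order a) (order b) (big a) (big b) (defect a) (defect b)
  where
  alg : ∀ s t ra rb pa pb →
    (s + t) * (s + t) + ((pa + pb) + (t * ra + s * rb)) ≡
    ((s * s + pa) + (t * t + pb)) + (t * (s + ra) + s * (t + rb))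
  alg = solve-∀

#conn-⊕ : ∀ a b → #conn (a ⊕ b) ≡ #conn a + #conn b
#conn-⊕ a b = alg (order a) (order b) (big a) (big b)
  where
  alg : ∀ s t ra rb → (s + t) + (ra + rb) ≡ (s + ra) + (t + rb)
  alg = solve-∀

-- Stars, and the numerical constants of the comparison with K₁ ∪ star

edgeless : ℕ → Cotree
edgeless zero    = leaf
edgeless (suc k) = leaf ⊕ edgeless k

order-edgeless : ∀ k → order (edgeless k) ≡ suc k
order-edgeless zero    = refl
order-edgeless (suc k) = cong suc (order-edgeless k)

big-edgeless : ∀ k → big (edgeless k) ≡ 0
big-edgeless zero    = refl
big-edgeless (suc k) = big-edgeless k

defect-edgeless : ∀ k → defect (edgeless k) ≡ 0
defect-edgeless zero    = refl
defect-edgeless (suc k)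
  rewrite big-edgeless k | defect-edgeless k | *-zeroʳ (order (edgeless k)) = refl

star : ℕ → Cotree
star j = leaf ⊗ edgeless j

-- K₁ ∪ star with j leaves has baseline j connected sets and deficit 2 * baseline j + surplus j.
baseline surplus : ℕ → ℕ
baseline j = 2 + j + nonempties j
surplus j = suc j * j

order-star : ∀ j → order (star j) ≡ 2 + j
order-star j = cong suc (order-edgeless j)

big-star : ∀ j → big (star j) ≡ nonempties (suc j)
big-star j rewrite order-edgeless j | big-edgeless j = alg (nonempties (suc j))
  where
  alg : ∀ y → 1 * y + 0 ≡ y
  alg = solve-∀

#conn-leaf⊕star : ∀ j → #conn (leaf ⊕ star j) ≡ baseline (suc j)
#conn-leaf⊕star j = cong₂ (λ h r → 1 + h + r) (order-star j) (big-star j)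

deficit-leaf⊕star : ∀ j → deficit (leaf ⊕ star j) ≡ 2 * baseline (suc j) + surplus (suc j)
deficit-leaf⊕star j = begin
  F (order (edgeless j)) (nonempties (order (edgeless j))) (big (edgeless j)) (defect (edgeless j))
    ≡⟨ cong (λ u → F u (nonempties u) (big (edgeless j)) (defect (edgeless j))) (order-edgeless j) ⟩
  F (suc j) (nonempties (suc j)) (big (edgeless j)) (defect (edgeless j))
    ≡⟨ cong₂ (F (suc j) (nonempties (suc j))) (big-edgeless j) (defect-edgeless j) ⟩
  F (suc j) (nonempties (suc j)) 0 0
    ≡⟨ cong (λ y → F (suc j) y 0 0) (nonempties≡ (suc j)) ⟩
  F (suc j) (suc j + excess (suc j)) 0 0
    ≡⟨ alg j (excess (suc j)) ⟩
  2 * (2 + suc j + (suc j + excess (suc j))) + surplus (suc j)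
    ≡⟨ cong (λ y → 2 * (2 + suc j + y) + surplus (suc j)) (nonempties≡ (suc j)) ⟨
  2 * baseline (suc j) + surplus (suc j) ∎
  where
  open ≡-Reasoning
  F : ℕ → ℕ → ℕ → ℕ → ℕ
  F u y r p = (2 + u) * (2 + u) +
    ((((1 * excess u + y * 0) + (p + (u * 0 + 1 * r)))) + ((1 + u) * 0 + 1 * (1 * y + r)))
  alg : ∀ j f →
    (2 + suc j) * (2 + suc j) +
      ((((1 * f + (suc j + f) * 0) + (0 + (suc j * 0 + 1 * 0))))
        + ((1 + suc j) * 0 + 1 * (1 * (suc j + f) + 0))) ≡
    2 * (2 + suc j + (suc j + f)) + (2 + j) * suc j
  alg = solve-∀

-- A quadratic minorant of 2 ^ (6 + k) - 1, exact at k = 0 and large enough for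
-- `5surplus≤3baseline`, which has little room at k = 0: 210 against 213.
nonempties-6+ : ∀ k → 2 * (k * k) + 22 * k + 63 ≤ nonempties (6 + k)
nonempties-6+ zero    = ≤-refl
nonempties-6+ (suc k) rewrite +-suc 6 k =
  ≤-trans (≤-by (2 * (k * k) + 18 * k + 40) (alg k))
          (s≤s (+-mono-≤ (nonempties-6+ k) (nonempties-6+ k)))
  where
  alg : ∀ k → 2 * (suc k * suc k) + 22 * suc k + 63 + (2 * (k * k) + 18 * k + 40) ≡
    suc ((2 * (k * k) + 22 * k + 63) + (2 * (k * k) + 22 * k + 63))
  alg = solve-∀

5surplus≤3baseline : ∀ k → 5 * surplus (6 + k) ≤ 3 * baseline (6 + k)
5surplus≤3baseline k = ≤-trans (≤-by (k * k + 4 * k + 3) (alg k))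
            (*-monoʳ-≤ 3 (+-monoʳ-≤ (8 + k) (nonempties-6+ k)))
  where
  alg : ∀ k → 5 * ((7 + k) * (6 + k)) + (k * k + 4 * k + 3) ≡
    3 * (8 + k + (2 * (k * k) + 22 * k + 63))
  alg = solve-∀

surplus≤baseline : ∀ k → surplus (6 + k) ≤ baseline (6 + k)
surplus≤baseline k =
  *-cancelˡ-≤ 5 (≤-trans (5surplus≤3baseline k) (*-monoˡ-≤ (baseline (6 + k)) (from-yes (3 ≤? 5))))

-- The analogous minorant from 8 on, exact at k = 0; its leading coefficients match those of three
-- times the surplus, leaving the constant slack 49 in `3surplus≤baseline`.
nonempties-8+ : ∀ k → 3 * (k * k) + 50 * k + 255 ≤ nonempties (8 + k)
nonempties-8+ zero    = ≤-refl
nonempties-8+ (suc k) rewrite +-suc 8 k =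
  ≤-trans (≤-by (3 * (k * k) + 44 * k + 203) (alg k))
          (s≤s (+-mono-≤ (nonempties-8+ k) (nonempties-8+ k)))
  where
  alg : ∀ k → 3 * (suc k * suc k) + 50 * suc k + 255 + (3 * (k * k) + 44 * k + 203) ≡
    suc ((3 * (k * k) + 50 * k + 255) + (3 * (k * k) + 50 * k + 255))
  alg = solve-∀

3surplus≤baseline : ∀ k → 3 * surplus (8 + k) ≤ baseline (8 + k)
3surplus≤baseline k = ≤-trans (≤-by 49 (alg k)) (+-monoʳ-≤ (10 + k) (nonempties-8+ k))
  where
  alg : ∀ k → 3 * ((9 + k) * (8 + k)) + 49 ≡ 10 + k + (3 * (k * k) + 50 * k + 255)
  alg = solve-∀

3nonempties≤5excess : ∀ i → 3 * nonempties (4 + i) ≤ 5 * excess (4 + i)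
3nonempties≤5excess zero    = from-yes (45 ≤? 55)
3nonempties≤5excess (suc i) = begin
  3 * suc (x + x)             ≡⟨ alg₁ x ⟩
  3 + 2 * (3 * x)             ≤⟨ +-monoʳ-≤ 3 (*-monoʳ-≤ 2 (3nonempties≤5excess i)) ⟩
  3 + 2 * (5 * e)             ≤⟨ ≤-by (17 + 5 * i) (alg₂ i e) ⟩
  5 * (4 + i + (e + e))       ∎
  where
  open ≤-Reasoning
  x = nonempties (4 + i) ; e = excess (4 + i)
  alg₁ : ∀ x → 3 * suc (x + x) ≡ 3 + 2 * (3 * x)
  alg₁ = solve-∀
  alg₂ : ∀ i e → 3 + 2 * (5 * e) + (17 + 5 * i) ≡ 5 * (4 + i + (e + e))
  alg₂ = solve-∀

half≤excess : ∀ i → 2 + i ≤ 2 * excess (2 + i)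
half≤excess zero    = ≤-refl
half≤excess (suc i) =
  ≤-trans (+-mono-≤ (from-yes (1 ≤? 2)) (half≤excess i)) (≤-by (2 + (2 * i + 2 * e)) (alg i e))
  where
  e = excess (2 + i)
  alg : ∀ i e → 2 + 2 * e + (2 + (2 * i + 2 * e)) ≡ 2 * (2 + i + (e + e))
  alg = solve-∀

-- excess s / nonempties s + excess t / nonempties t ≥ 3 / 5, cleared of denominators.
ExcessBound : ℕ → ℕ → Set
ExcessBound s t =
  3 * (nonempties s * nonempties t) ≤ 5 * (nonempties s * excess t + nonempties t * excess s)

-- The ratio of `excess` to `nonempties` is at least 3 / 5 from 4 on, so one part of order at least
-- 4 suffices. Otherwise both parts have order at most 3, and s + t ≥ 6 leaves only 3 + 3.
excessBound : ∀ s t → 6 ≤ s + t → ExcessBound s t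
excessBound s t 6≤ with 4 ≤? t | 4 ≤? s
... | yes 4≤t | _ = subst (ExcessBound s)
                      (m+[n∸m]≡n 4≤t) (begin
  3 * (x * nonempties t′)             ≡⟨ alg x (nonempties t′) 3 ⟩
  x * (3 * nonempties t′)             ≤⟨ *-monoʳ-≤ x (3nonempties≤5excess (t ∸ 4)) ⟩
  x * (5 * excess t′)                 ≡⟨ alg x (excess t′) 5 ⟨
  5 * (x * excess t′)
    ≤⟨ *-monoʳ-≤ 5 (m≤m+n (x * excess t′) (nonempties t′ * excess s)) ⟩
  5 * (x * excess t′ + nonempties t′ * excess s) ∎)
  where
  open ≤-Reasoning
  x = nonempties s
  t′ = 4 + (t ∸ 4)
  alg : ∀ x y k → k * (x * y) ≡ x * (k * y)
  alg = solve-∀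
... | no _ | yes 4≤s = subst (λ s → ExcessBound s t)
                      (m+[n∸m]≡n 4≤s) (begin
  3 * (nonempties s′ * y)             ≡⟨ alg (nonempties s′) y 3 ⟩
  y * (3 * nonempties s′)             ≤⟨ *-monoʳ-≤ y (3nonempties≤5excess (s ∸ 4)) ⟩
  y * (5 * excess s′)                 ≡⟨ alg′ y (excess s′) 5 ⟨
  5 * (y * excess s′)
    ≤⟨ *-monoʳ-≤ 5 (m≤n+m (y * excess s′) (nonempties s′ * excess t)) ⟩
  5 * (nonempties s′ * excess t + y * excess s′) ∎)
  where
  open ≤-Reasoning
  y = nonempties t
  s′ = 4 + (s ∸ 4)
  alg : ∀ x y k → k * (x * y) ≡ y * (k * x)
  alg = solve-∀
  alg′ : ∀ x y k → k * (x * y) ≡ x * (k * y)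
  alg′ = solve-∀
... | no 4≰t | no 4≰s = subst₂ ExcessBound
    (≤-antisym (+-cancelʳ-≤ 3 _ _ (≤-trans 6≤ (+-monoʳ-≤ s t≤3))) s≤3)
    (≤-antisym (+-cancelˡ-≤ 3 _ _ (≤-trans 6≤ (+-monoˡ-≤ t s≤3))) t≤3)
    (from-yes (147 ≤? 280))
  where
  t≤3 = ≤-pred (≰⇒> 4≰t)
  s≤3 = ≤-pred (≰⇒> 4≰s)

big≤weighted : ∀ a b → big a + big b ≤ order b * big a + order a * big b
big≤weighted a b =
  +-mono-≤ (scale (order b) (big a) (1≤order b)) (scale (order a) (big b) (1≤order a))
  where
  scale : ∀ k r → 1 ≤ k → r ≤ k * r
  scale k r 1≤k = ≤-trans (≤-reflexive (sym (*-identityˡ r))) (*-monoˡ-≤ r 1≤k)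

surplus*big≤defect*baseline : ∀ k a → order a ≡ 6 + k →
  surplus (6 + k) * big a ≤ defect a * baseline (6 + k)
surplus*big≤defect*baseline k leaf ()
surplus*big≤defect*baseline k (a ⊕ b) eq = begin
  surplus j * (big a + big b)        ≤⟨ *-mono-≤ (surplus≤baseline k) (≤-trans (big≤weighted a b)
      (m≤n+m (order b * big a + order a * big b) (defect a + defect b))) ⟩
  baseline j * defect (a ⊕ b)         ≡⟨ *-comm (baseline j) (defect (a ⊕ b)) ⟩
  defect (a ⊕ b) * baseline j         ∎
  where
  open ≤-Reasoning
  j = 6 + k
surplus*big≤defect*baseline k (a ⊗ b) eq = begin
  surplus j * (x * y + (ra + rb))            ≡⟨ *-distribˡ-+ (surplus j) (x * y) (ra + rb) ⟩
  surplus j * (x * y) + surplus j * (ra + rb)      ≤⟨ +-mono-≤ main rest ⟩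
  baseline j * q + baseline j * (pp + rr)            ≡⟨ alg (baseline j) q (pp + rr) ⟩
  (q + (pp + rr)) * baseline j                ∎
  where
  open ≤-Reasoning
  j = 6 + k
  x = nonempties (order a) ; y = nonempties (order b) ; ra = big a ; rb = big b
  e = excess (order a) ; f = excess (order b)
  q = x * f + y * e
  pp = defect a + defect b
  rr = order b * ra + order a * rb
  alg : ∀ b q r → b * q + b * r ≡ (q + r) * b
  alg = solve-∀
  rest : surplus j * (ra + rb) ≤ baseline j * (pp + rr)
  rest = *-mono-≤ (surplus≤baseline k) (≤-trans (big≤weighted a b)
      (m≤n+m (order b * big a + order a * big b) (defect a + defect b)))
  main : surplus j * (x * y) ≤ baseline j * q
  main = *-cancelˡ-≤ 5 (begin
    5 * (surplus j * (x * y))  ≡⟨ *-assoc 5 (surplus j) (x * y) ⟨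
    5 * surplus j * (x * y)    ≤⟨ *-monoˡ-≤ (x * y) (5surplus≤3baseline k) ⟩
    3 * baseline j * (x * y)    ≡⟨ alg₂ (baseline j) (x * y) ⟩
    baseline j * (3 * (x * y))  ≤⟨ *-monoʳ-≤ (baseline j) (excessBound (order a) (order b)
                                (≤-trans (m≤m+n 6 k) (≤-reflexive (sym eq)))) ⟩
    baseline j * (5 * q)        ≡⟨ alg₃ (baseline j) q ⟩
    5 * (baseline j * q)        ∎)
    where
    alg₂ : ∀ b z → 3 * b * z ≡ b * (3 * z)
    alg₂ = solve-∀
    alg₃ : ∀ b q → b * (5 * q) ≡ 5 * (b * q)
    alg₃ = solve-∀

-- joinConn s t = 1 + #conn c and joinDeficit s t = order c + deficit c for the join c of two
-- edgeless graphs of orders s and t.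
joinConn joinDeficit : ℕ → ℕ → ℕ
joinConn s t    = 1 + (s + t) + nonempties s * nonempties t
joinDeficit s t =
  (s + t) + ((s + t) * (s + t) + (nonempties s * excess t + nonempties t * excess s))

-- The only fact used about the excesses e and f is 2 e ≥ s and 2 f ≥ t. After doubling and writing
-- 2 e = s + u, 2 f = t + v, the difference of the two sides is a polynomial in i, l, u, v with
-- nonnegative coefficients.
4joinConn≤3joinDeficit : ∀ i l → 4 * joinConn (2 + i) (2 + l) ≤ 3 * joinDeficit (2 + i) (2 + l)
4joinConn≤3joinDeficit i l = subst₂
  (λ x y → 4 * (1 + (s + t) + x * y) ≤ 3 * ((s + t) + ((s + t) * (s + t) + (x * f + y * e))))
  (sym (nonempties≡ s)) (sym (nonempties≡ t)) (*-cancelˡ-≤ 2 (begin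
  2 * (4 * (1 + (s + t) + (s + e) * (t + f)))                ≡⟨ alg₁ s t e f ⟩
  P (2 * e) (2 * f)                                          ≡⟨ cong₂ P E≡ F≡ ⟨
  P (s + u) (t + v)                                          ≤⟨ ≤-by _ (alg₂ i l u v) ⟩
  R (s + u) (t + v)                                          ≡⟨ cong₂ R E≡ F≡ ⟩
  R (2 * e) (2 * f)                                          ≡⟨ alg₃ s t e f ⟩
  2 * (3 * ((s + t) + ((s + t) * (s + t) + ((s + e) * f + (t + f) * e)))) ∎))
  where
  open ≤-Reasoning
  s = 2 + i ; t = 2 + l ; e = excess s ; f = excess t
  u = 2 * e ∸ s ; v = 2 * f ∸ t
  E≡ : s + u ≡ 2 * e
  E≡ = m+[n∸m]≡n (half≤excess i)
  F≡ : t + v ≡ 2 * f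
  F≡ = m+[n∸m]≡n (half≤excess l)
  P R : ℕ → ℕ → ℕ
  P E F = 8 + 8 * (s + t) + 8 * (s * t) + 4 * (s * F) + 4 * (t * E) + 2 * (E * F)
  R E F = 6 * (s + t) + 6 * ((s + t) * (s + t)) + 3 * (s * F) + 3 * (t * E) + 3 * (E * F)
  alg₁ : ∀ s t e f → 2 * (4 * (1 + (s + t) + (s + e) * (t + f))) ≡
    8 + 8 * (s + t) + 8 * (s * t) + 4 * (s * (2 * f)) + 4 * (t * (2 * e)) + 2 * ((2 * e) * (2 * f))
  alg₁ = solve-∀
  alg₂ : ∀ i l u v →
    8 + 8 * ((2 + i) + (2 + l)) + 8 * ((2 + i) * (2 + l)) + 4 * ((2 + i) * (2 + l + v))
      + 4 * ((2 + l) * (2 + i + u)) + 2 * ((2 + i + u) * (2 + l + v))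
      + (44 + 28 * i + 28 * l + 6 * (i * i) + 6 * (l * l) + 3 * (i * l) + u * v) ≡
    6 * ((2 + i) + (2 + l)) + 6 * (((2 + i) + (2 + l)) * ((2 + i) + (2 + l)))
      + 3 * ((2 + i) * (2 + l + v)) + 3 * ((2 + l) * (2 + i + u)) + 3 * ((2 + i + u) * (2 + l + v))
  alg₂ = solve-∀
  alg₃ : ∀ s t e f →
    6 * (s + t) + 6 * ((s + t) * (s + t)) + 3 * (s * (2 * f)) + 3 * (t * (2 * e))
      + 3 * ((2 * e) * (2 * f)) ≡
    2 * (3 * ((s + t) + ((s + t) * (s + t) + ((s + e) * f + (t + f) * e))))
  alg₃ = solve-∀

-- This is `IsolatedBound` for the join of two edgeless graphs, with j decoupled from s + t so that
-- the asymptotic case can treat them independently.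
JoinBound : ℕ → ℕ → ℕ → Set
JoinBound j s t = (baseline j + surplus j) * joinConn s t ≤ joinDeficit s t * baseline j

joinBound-asymptotic : ∀ k i l → JoinBound (8 + k) (2 + i) (2 + l)
joinBound-asymptotic k i l = *-cancelˡ-≤ 3 (begin
  3 * ((b + d) * x)      ≡⟨ alg₁ b d x ⟩
  (3 * b + 3 * d) * x    ≤⟨ *-monoˡ-≤ x (+-monoʳ-≤ (3 * b) (3surplus≤baseline k)) ⟩
  (3 * b + b) * x        ≡⟨ alg₂ b x ⟩
  b * (4 * x)            ≤⟨ *-monoʳ-≤ b (4joinConn≤3joinDeficit i l) ⟩
  b * (3 * y)            ≡⟨ alg₃ b y ⟩
  3 * (y * b)            ∎)
  where
  open ≤-Reasoning
  b = baseline (8 + k) ; d = surplus (8 + k) ; x = joinConn (2 + i) (2 + l)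
  y = joinDeficit (2 + i) (2 + l)
  alg₁ : ∀ b d x → 3 * ((b + d) * x) ≡ (3 * b + 3 * d) * x
  alg₁ = solve-∀
  alg₂ : ∀ b x → (3 * b + b) * x ≡ b * (4 * x)
  alg₂ = solve-∀
  alg₃ : ∀ b y → b * (3 * y) ≡ 3 * (y * b)
  alg₃ = solve-∀

joinBound? : ∀ j s t → Dec (JoinBound j s t)
joinBound? j s t = (baseline j + surplus j) * joinConn s t ≤? joinDeficit s t * baseline j

-- From j = 8 on the surplus is at most a third of the baseline, which matches the ratio 4 / 3 of
-- `4joinConn≤3joinDeficit`. For j = 6 and j = 7 it is larger than a third, and the few pairs with
-- the prescribed sum are evaluated.
joinBound : ∀ k i l → 4 + i + l ≡ 7 + k → JoinBound (6 + k) (2 + i) (2 + l)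
joinBound (suc (suc k)) i l _ = joinBound-asymptotic k i l
joinBound 0 i l eq =
  subst (λ l → JoinBound 6 (2 + i) (2 + l)) l≡
    (from-yes (allUpTo? (λ i → joinBound? 6 (2 + i) (2 + (3 ∸ i))) 4)
      (s≤s (m+n≤o⇒m≤o i (≤-reflexive i+l≡3))))
  where
  i+l≡3 : i + l ≡ 3
  i+l≡3 = +-cancelˡ-≡ 4 (i + l) 3 eq
  l≡ : 3 ∸ i ≡ l
  l≡ = trans (cong (_∸ i) (sym i+l≡3)) (m+n∸m≡n i l)
joinBound 1 i l eq =
  subst (λ l → JoinBound 7 (2 + i) (2 + l)) l≡
    (from-yes (allUpTo? (λ i → joinBound? 7 (2 + i) (2 + (4 ∸ i))) 5)
      (s≤s (m+n≤o⇒m≤o i (≤-reflexive i+l≡4))))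
  where
  i+l≡4 : i + l ≡ 4
  i+l≡4 = +-cancelˡ-≡ 4 (i + l) 4 eq
  l≡ : 4 ∸ i ≡ l
  l≡ = trans (cong (_∸ i) (sym i+l≡4)) (m+n∸m≡n i l)

baseline+surplus≤2baseline : ∀ k → baseline (6 + k) + surplus (6 + k) ≤ baseline (6 + k) * 2
baseline+surplus≤2baseline k = ≤-trans (+-monoʳ-≤ (baseline (6 + k)) (surplus≤baseline k))
  (≤-reflexive (alg (baseline (6 + k))))
  where
  alg : ∀ b → b + b ≡ b * 2
  alg = solve-∀

-- The bound for K₁ ∪ H rewritten in terms of H; equality holds for the star.
IsolatedBound : ℕ → Cotree → Set
IsolatedBound k b =
  (baseline (6 + k) + surplus (6 + k)) * (1 + #conn b) ≤ (7 + k + deficit b) * baseline (6 + k)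

-- With B the baseline, σ the surplus, r = `big d` and p = `defect d`, the claim reads (B + σ) (B +
-- r) ≤ (B + σ + r + p) B, which is σ r ≤ p B. Both sides vanish for edgeless `d`, the case of the
-- star.
isolatedBound-leaf⊗ : ∀ k d → order d ≡ 6 + k → IsolatedBound k (leaf ⊗ d)
isolatedBound-leaf⊗ k d eq = begin
  (b + surplus j) * (1 + ((1 + order d) + (1 * nonempties (order d) + r)))
    ≡⟨ cong (λ h → (b + surplus j) * (1 + ((1 + h) + (1 * nonempties h + r)))) eq ⟩
  (b + surplus j) * (1 + ((1 + j) + (1 * nonempties j + r)))
    ≡⟨ alg₁ (surplus j) j (nonempties j) r ⟩
  (b + surplus j + r) * b + surplus j * r
    ≤⟨ +-monoʳ-≤ ((b + surplus j + r) * b) (surplus*big≤defect*baseline k d eq) ⟩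
  (b + surplus j + r) * b + p * b           ≡⟨ *-distribʳ-+ b (b + surplus j + r) p ⟨
  (b + surplus j + r + p) * b
    ≡⟨ cong (_* b) {x = b + surplus j + r + p} {y = target} coefficient ⟩
  target * b                                ∎
  where
  open ≤-Reasoning
  j = 6 + k ; b = baseline j ; r = big d ; p = defect d
  alg₁ : ∀ d j y r → (2 + j + y + d) * (1 + ((1 + j) + (1 * y + r))) ≡
    (2 + j + y + d + r) * (2 + j + y) + d * r
  alg₁ = solve-∀
  alg₂ : ∀ j y r p f → 2 + j + (j + f) + (1 + j) * j + r + p ≡
    suc j + ((1 + j) * (1 + j) + ((1 * f + y * 0) + (p + (j * 0 + 1 * r))))
  alg₂ = solve-∀
  target = suc j + deficit (leaf ⊗ d)
  coefficient : b + surplus j + r + p ≡ target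
  coefficient = trans (cong (λ y → 2 + j + y + surplus j + r + p) (nonempties≡ j))
    (trans (alg₂ j (nonempties j) r p (excess j))
      (cong (λ h → suc j + ((1 + h) * (1 + h) +
        ((1 * excess h + nonempties h * 0) + (p + (h * 0 + 1 * r))))) (sym eq)))

isolatedBound-⊕ : ∀ k a b → IsolatedBound k (a ⊕ b)
isolatedBound-⊕ k a b = begin
  (baseline j + surplus j) * (1 + #conn (a ⊕ b))
    ≤⟨ *-monoˡ-≤ (1 + #conn (a ⊕ b)) (baseline+surplus≤2baseline k) ⟩
  baseline j * 2 * (1 + #conn (a ⊕ b))
    ≡⟨ cong (λ c → baseline j * 2 * (1 + c)) (#conn-⊕ a b) ⟩
  baseline j * 2 * (1 + (ca + cb))           ≡⟨ alg (baseline j) ca cb ⟩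
  (2 + ((ca + cb) + (1 * ca + 1 * cb))) * baseline j
    ≤⟨ *-monoˡ-≤ (baseline j) (+-mono-≤ (m≤m+n 2 (5 + k)) (+-mono-≤
         (+-mono-≤ (#conn≤deficit a) (#conn≤deficit b))
         (+-mono-≤ (*-monoˡ-≤ ca (1≤order b)) (*-monoˡ-≤ cb (1≤order a))))) ⟩
  (7 + k + ((deficit a + deficit b) + (order b * ca + order a * cb))) * baseline j
    ≡⟨ cong (λ d → (7 + k + d) * baseline j) (deficit-⊕ a b) ⟨
  (7 + k + deficit (a ⊕ b)) * baseline j     ∎
  where
  open ≤-Reasoning
  j = 6 + k ; ca = #conn a ; cb = #conn b
  alg : ∀ b x y → b * 2 * (1 + (x + y)) ≡ (2 + ((x + y) + (1 * x + 1 * y))) * b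
  alg = solve-∀

-- The bound is a sum of two: `JoinBound`, as if both sides were edgeless, and one for the big sets
-- inside the sides. The latter carry weights `order b` and `order a`, both at least 2, while the
-- baseline plus the surplus is at most twice the baseline.
isolatedBound-⊗ : ∀ k a b → 2 ≤ order a → 2 ≤ order b → order a + order b ≡ 7 + k →
  IsolatedBound k (a ⊗ b)
isolatedBound-⊗ k a b 2≤s 2≤t eq = begin
  (baseline j + surplus j) * (1 + ((s + t) + (x * y + (ra + rb))))
    ≡⟨ alg₁ (baseline j + surplus j) (s + t) (x * y) (ra + rb) ⟩
  (baseline j + surplus j) * joinConn s t + (baseline j + surplus j) * (ra + rb)
    ≤⟨ +-mono-≤ main rest ⟩
  joinDeficit s t * baseline j + (pp + (t * ra + s * rb)) * baseline j
    ≡⟨ alg₂ (baseline j) (s + t) ((s + t) * (s + t)) (x * excess t + y * excess s) (pp + (t * ra + s * rb)) ⟩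
  (s + t + ((s + t) * (s + t) + ((x * excess t + y * excess s) + (pp + (t * ra + s * rb))))) * baseline j
    ≡⟨ cong (λ m → (m + deficit (a ⊗ b)) * baseline j) {x = s + t} {y = 7 + k} eq ⟩
  (7 + k + deficit (a ⊗ b)) * baseline j     ∎
  where
  open ≤-Reasoning
  j = 6 + k ; s = order a ; t = order b ; x = nonempties s ; y = nonempties t
  ra = big a ; rb = big b ; pp = defect a + defect b
  alg₁ : ∀ c m z r → c * (1 + (m + (z + r))) ≡ c * (1 + m + z) + c * r
  alg₁ = solve-∀
  alg₂ : ∀ b m mm q z → (m + (mm + q)) * b + z * b ≡ (m + (mm + (q + z))) * b
  alg₂ = solve-∀
  s≡ : 2 + (s ∸ 2) ≡ s
  s≡ = m+[n∸m]≡n 2≤s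
  t≡ : 2 + (t ∸ 2) ≡ t
  t≡ = m+[n∸m]≡n 2≤t
  alg₃ : ∀ i l → 4 + i + l ≡ (2 + i) + (2 + l)
  alg₃ = solve-∀
  main : JoinBound j s t
  main = subst₂ (JoinBound j) s≡ t≡
    (joinBound k (s ∸ 2) (t ∸ 2) (trans (alg₃ (s ∸ 2) (t ∸ 2)) (trans (cong₂ _+_ s≡ t≡) eq)))
  rest : (baseline j + surplus j) * (ra + rb) ≤ (pp + (t * ra + s * rb)) * baseline j
  rest = begin
    (baseline j + surplus j) * (ra + rb)
      ≤⟨ *-monoˡ-≤ (ra + rb) (baseline+surplus≤2baseline k) ⟩
    baseline j * 2 * (ra + rb)          ≡⟨ alg₄ (baseline j) ra rb ⟩
    (2 * ra + 2 * rb) * baseline j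
      ≤⟨ *-monoˡ-≤ (baseline j) (≤-trans (+-mono-≤ (*-monoˡ-≤ ra 2≤t) (*-monoˡ-≤ rb 2≤s)) (m≤n+m _ pp)) ⟩
    (pp + (t * ra + s * rb)) * baseline j ∎
    where
    alg₄ : ∀ b x y → b * 2 * (x + y) ≡ (2 * x + 2 * y) * b
    alg₄ = solve-∀

isolatedBound : ∀ k b → order b ≡ 7 + k → IsolatedBound k b
isolatedBound k leaf ()
isolatedBound k (a ⊕ b) eq = isolatedBound-⊕ k a b
isolatedBound k (a ⊗ b) eq with leaf-or-2≤order a | leaf-or-2≤order b
... | inj₁ refl | _         = isolatedBound-leaf⊗ k b (suc-injective eq)
... | inj₂ _    | inj₁ refl = subst₂
  (λ c d → (baseline (6 + k) + surplus (6 + k)) * (1 + c) ≤ (7 + k + d) * baseline (6 + k))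
  (#conn-⊗-comm leaf a) (deficit-⊗-comm leaf a)
  (isolatedBound-leaf⊗ k a (+-cancelʳ-≡ 1 (order a) (6 + k) (trans eq (+-comm 1 (6 + k)))))
... | inj₂ 2≤s  | inj₂ 2≤t  = isolatedBound-⊗ k a b 2≤s 2≤t eq

DeficitBound : ℕ → Cotree → Set
DeficitBound k g = (2 * baseline (6 + k) + surplus (6 + k)) * #conn g ≤ deficit g * baseline (6 + k)

deficitBound-leaf⊕ : ∀ k b → order b ≡ 7 + k → DeficitBound k (leaf ⊕ b)
deficitBound-leaf⊕ k b eq = begin
  (2 * baseline j + surplus j) * #conn (leaf ⊕ b)
    ≡⟨ cong ((2 * baseline j + surplus j) *_) (#conn-⊕ leaf b) ⟩
  -- The isolated vertex contributes the cross term `#conn b` and its own unit to the deficit; this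
  -- accounts for one of the two baselines.
  (2 * baseline j + surplus j) * (1 + c)               ≡⟨ alg₁ (baseline j) (surplus j) c ⟩
  (baseline j + surplus j) * (1 + c) + (1 + c) * baseline j
    ≤⟨ +-monoˡ-≤ ((1 + c) * baseline j) (isolatedBound k b eq) ⟩
  (7 + k + deficit b) * baseline j + (1 + c) * baseline j
    ≡⟨ cong (λ m → (m + deficit b) * baseline j + (1 + c) * baseline j) eq ⟨
  (order b + deficit b) * baseline j + (1 + c) * baseline j
    ≡⟨ alg₂ (order b) (deficit b) c (baseline j) ⟩
  (1 + deficit b + (order b * 1 + 1 * c)) * baseline j ≡⟨ cong (_* baseline j) (deficit-⊕ leaf b) ⟨
  deficit (leaf ⊕ b) * baseline j                ∎
  where
  open ≤-Reasoning
  j = 6 + k ; c = #conn b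
  alg₁ : ∀ b d c → (2 * b + d) * (1 + c) ≡ (b + d) * (1 + c) + (1 + c) * b
  alg₁ = solve-∀
  alg₂ : ∀ m d c b → (m + d) * b + (1 + c) * b ≡ (1 + d + (m * 1 + 1 * c)) * b
  alg₂ = solve-∀

deficitBound : ∀ k a b → order a + order b ≡ 8 + k → DeficitBound k (a ⊕ b)
deficitBound k a b eq with leaf-or-2≤order a | leaf-or-2≤order b
... | inj₁ refl | _ = deficitBound-leaf⊕ k b (suc-injective eq)
... | inj₂ _ | inj₁ refl = subst₂
  (λ c d → (2 * baseline (6 + k) + surplus (6 + k)) * c ≤ d * baseline (6 + k))
  (#conn-⊕-comm leaf a) (deficit-⊕-comm leaf a)
  (deficitBound-leaf⊕ k a (+-cancelʳ-≡ 1 (order a) (7 + k) (trans eq (+-comm 1 (7 + k)))))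
... | inj₂ 2≤s | inj₂ 2≤t = begin
  (2 * baseline j + surplus j) * #conn (a ⊕ b)
    ≤⟨ *-monoˡ-≤ (#conn (a ⊕ b)) (+-monoʳ-≤ (2 * baseline j) (surplus≤baseline k)) ⟩
  (2 * baseline j + baseline j) * #conn (a ⊕ b)
    ≡⟨ cong ((2 * baseline j + baseline j) *_) (#conn-⊕ a b) ⟩
  (2 * baseline j + baseline j) * (ca + cb)         ≡⟨ alg (baseline j) ca cb ⟩
  ((ca + cb) + (2 * ca + 2 * cb)) * baseline j
    ≤⟨ *-monoˡ-≤ (baseline j) (+-mono-≤ (+-mono-≤ (#conn≤deficit a) (#conn≤deficit b))
         (+-mono-≤ (*-monoˡ-≤ ca 2≤t) (*-monoˡ-≤ cb 2≤s))) ⟩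
  ((deficit a + deficit b) + (order b * ca + order a * cb)) * baseline j
    ≡⟨ cong (_* baseline j) (deficit-⊕ a b) ⟨
  deficit (a ⊕ b) * baseline j               ∎
  where
  open ≤-Reasoning
  j = 6 + k ; ca = #conn a ; cb = #conn b
  alg : ∀ b x y → (2 * b + b) * (x + y) ≡ ((x + y) + (2 * x + 2 * y)) * b
  alg = solve-∀

-- Minimality of the star, and adding an isolated vertex

nonempties-+ : ∀ m n →
  nonempties (m + n) ≡ nonempties m * nonempties n + (nonempties m + nonempties n)
nonempties-+ zero    n = refl
nonempties-+ (suc m) n rewrite nonempties-+ m n = alg (nonempties m) (nonempties n)
  where
  alg : ∀ x y → suc (x * y + (x + y) + (x * y + (x + y))) ≡ suc (x + x) * y + (suc (x + x) + y)
  alg = solve-∀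

nonempties-product : ∀ i l → nonempties (suc (i + l)) ≤ nonempties (suc i) * nonempties (suc l)
nonempties-product i l rewrite nonempties-+ i l = ≤-by (2 * (x * y)) (alg x y)
  where
  x = nonempties i ; y = nonempties l
  alg : ∀ x y → suc (x * y + (x + y) + (x * y + (x + y))) + 2 * (x * y) ≡ suc (x + x) * suc (y + y)
  alg = solve-∀

-- All big connected sets of the star cross its join, and the crossing sets of any join of the same
-- order are already at least as many.
#conn-star-minimal : ∀ j a b → order (a ⊗ b) ≡ order (star j) → #conn (star j) ≤ #conn (a ⊗ b)
#conn-star-minimal j a b eq = +-mono-≤ (≤-reflexive (sym eq)) (begin
  big (star j)                        ≡⟨ big-star j ⟩
  nonempties (suc j)                  ≡⟨ cong nonempties (suc-injective sizes) ⟨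
  nonempties (suc (i + l))            ≤⟨ nonempties-product i l ⟩
  nonempties (suc i) * nonempties (suc l) ≡⟨ cong₂ (λ s t → nonempties s * nonempties t) s≡ t≡ ⟩
  nonempties (order a) * nonempties (order b) ≤⟨ m≤m+n _ _ ⟩
  big (a ⊗ b)                         ∎)
  where
  open ≤-Reasoning
  i = order a ∸ 1 ; l = order b ∸ 1
  s≡ : suc i ≡ order a
  s≡ = m+[n∸m]≡n (1≤order a)
  t≡ : suc l ≡ order b
  t≡ = m+[n∸m]≡n (1≤order b)
  sizes : suc (suc (i + l)) ≡ suc (suc j)
  sizes = trans (cong suc (sym (+-suc i l))) (trans (cong₂ _+_ s≡ t≡) (trans eq (order-star j)))

big≤bigSize : ∀ a → big a ≤ bigSize a
big≤bigSize leaf    = z≤n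
big≤bigSize (a ⊕ b) = +-mono-≤ (big≤bigSize a) (big≤bigSize b)
big≤bigSize (a ⊗ b) = +-mono-≤
  (≤-trans (*-monoˡ-≤ (nonempties (order b)) (nonempties≤totalSize (order a))) (m≤m+n _ _))
  (+-mono-≤ (big≤bigSize a) (big≤bigSize b))
  where
  nonempties≤totalSize : ∀ n → nonempties n ≤ totalSize n
  nonempties≤totalSize zero    = z≤n
  nonempties≤totalSize (suc n) = ≤-trans (s≤s (+-monoʳ-≤ (nonempties n) (nonempties≤totalSize n)))
    (+-monoˡ-≤ (totalSize n) (m≤n+m (suc (nonempties n)) (totalSize n)))

-- Multiplied out, the claim exceeds the last hypothesis by W + S′ ≤ W′ + S. Multiplied by S, this
-- follows from that hypothesis and (W - S) (S′ - S) ≥ 0: a mean of at least 1 is pulled down less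
-- by the new singleton when there are more sets.
meanWithPoint : ∀ S W S′ W′ → 1 ≤ S → S ≤ W → S ≤ S′ → W * S′ ≤ W′ * S →
  suc W * suc S′ ≤ suc W′ * suc S
meanWithPoint S W S′ W′ 1≤S S≤W S≤S′ le =
  subst₂ _≤_ (alg₁ W S′) (alg₁ W′ S) (+-monoʳ-≤ 1 (+-mono-≤ gain le))
  where
  open ≤-Reasoning
  alg₁ : ∀ w s → 1 + ((w + s) + w * s) ≡ suc w * suc s
  alg₁ = solve-∀
  u = W ∸ S ; v = S′ ∸ S
  alg₂ : ∀ s u v → (s + u + (s + v)) * s + u * v ≡ (s + u) * (s + v) + s * s
  alg₂ = solve-∀
  gain : W + S′ ≤ W′ + S
  gain = *-cancelʳ-≤ (W + S′) (W′ + S) S {{>-nonZero 1≤S}} (begin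
    (W + S′) * S      ≤⟨ m≤m+n _ (u * v) ⟩
    (W + S′) * S + u * v ≡⟨ cong₂ (λ w s → (w + s) * S + u * v) (m+[n∸m]≡n S≤W) (m+[n∸m]≡n S≤S′) ⟨
    (S + u + (S + v)) * S + u * v ≡⟨ alg₂ S u v ⟩
    (S + u) * (S + v) + S * S ≡⟨ cong₂ (λ w s → w * s + S * S) (m+[n∸m]≡n S≤W) (m+[n∸m]≡n S≤S′) ⟩
    W * S′ + S * S    ≤⟨ +-monoˡ-≤ (S * S) le ⟩
    W′ * S + S * S    ≡⟨ *-distribʳ-+ S W′ S ⟨
    (W′ + S) * S      ∎)

1≤#conn : ∀ a → 1 ≤ #conn a
1≤#conn a = ≤-trans (1≤order a) (m≤m+n _ _)

isolated-mono : ∀ a b → #conn a ≤ #conn b →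
  sizeSum a * #conn b ≤ sizeSum b * #conn a →
  sizeSum (leaf ⊕ a) * #conn (leaf ⊕ b) ≤ sizeSum (leaf ⊕ b) * #conn (leaf ⊕ a)
isolated-mono a b =
  meanWithPoint (#conn a) (sizeSum a) (#conn b) (sizeSum b)
    (1≤#conn a) (+-monoʳ-≤ (order a) (big≤bigSize a))

≤-mean-trans : ∀ {W₁ S₁ W₂ S₂ W₃ S₃} → 1 ≤ S₂ →
  W₁ * S₂ ≤ W₂ * S₁ → W₂ * S₃ ≤ W₃ * S₂ → W₁ * S₃ ≤ W₃ * S₁
≤-mean-trans {W₁} {S₁} {W₂} {S₂} {W₃} {S₃} 1≤S₂ p q =
  *-cancelʳ-≤ (W₁ * S₃) (W₃ * S₁) S₂ {{>-nonZero 1≤S₂}} (begin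
    W₁ * S₃ * S₂  ≡⟨ alg W₁ S₃ S₂ ⟩
    W₁ * S₂ * S₃  ≤⟨ *-monoˡ-≤ S₃ p ⟩
    W₂ * S₁ * S₃  ≡⟨ alg W₂ S₁ S₃ ⟩
    W₂ * S₃ * S₁  ≤⟨ *-monoˡ-≤ S₁ q ⟩
    W₃ * S₂ * S₁  ≡⟨ alg W₃ S₂ S₁ ⟩
    W₃ * S₁ * S₂  ∎)
  where
  open ≤-Reasoning
  alg : ∀ x y z → x * y * z ≡ x * z * y
  alg = solve-∀

_≼_ : Cotree → Cotree → Set
a ≼ b = sizeSum a * #conn b ≤ sizeSum b * #conn a

large-order : ∀ k a b c d → order a + order b ≡ 8 + k → order (c ⊗ d) ≡ 7 + k →
  star (5 + k) ≼ (c ⊗ d) → (a ⊕ b) ≼ (leaf ⊕ c ⊗ d)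
large-order k a b c d eq eq′ star≼ =
  ≤-mean-trans {sizeSum (a ⊕ b)} {#conn (a ⊕ b)} {sizeSum τ} {#conn τ} {sizeSum (leaf ⊕ c ⊗ d)}
    (1≤#conn τ)
    (deficit⇒mean (a ⊕ b) τ (trans eq (sym (cong suc (order-star (5 + k)))))
      (subst₂ (λ x y → x * #conn (a ⊕ b) ≤ deficit (a ⊕ b) * y)
        (sym (deficit-leaf⊕star (5 + k))) (sym (#conn-leaf⊕star (5 + k))) (deficitBound k a b eq)))
    (isolated-mono (star (5 + k)) (c ⊗ d)
      (#conn-star-minimal (5 + k) c d (trans eq′ (sym (order-star (5 + k))))) star≼)
  where
  τ = leaf ⊕ star (5 + k)

-- The comparison up to order 7

-- Triples of numbers, so that finite checks run by evaluation. On profiles of cotrees `_≼ᵖ_`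
-- unfolds to `_≼_`, and no conversion is required.
Profile : Set
Profile = ℕ × ℕ × ℕ

_≟ᵖ_ : DecidableEquality Profile
_≟ᵖ_ = ≡-dec _≟_ (≡-dec _≟_ _≟_)

profile : Cotree → Profile
profile a = order a , big a , bigSize a

_⊕ᵖ_ _⊗ᵖ_ : Profile → Profile → Profile
(s , r , w) ⊕ᵖ (s′ , r′ , w′) = s + s′ , r + r′ , w + w′
(s , r , w) ⊗ᵖ (s′ , r′ , w′) =
  s + s′ ,
  nonempties s * nonempties s′ + (r + r′) ,
  (totalSize s * nonempties s′ + nonempties s * totalSize s′) + (w + w′)

_≼ᵖ_ : Profile → Profile → Set
(s , r , w) ≼ᵖ (s′ , r′ , w′) = (s + w) * (s′ + r′) ≤ (s′ + w′) * (s + r)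

_≼ᵖ?_ : ∀ p q → Dec (p ≼ᵖ q)
(s , r , w) ≼ᵖ? (s′ , r′ , w′) = (s + w) * (s′ + r′) ≤? (s′ + w′) * (s + r)

-- Both parts of a compound cotree of order at most k + 1 have order at most k, so one round of
-- combinations per order is exhaustive. Removing duplicates and oversized triples keeps the
-- evaluation feasible.
profiles : ℕ → List Profile
profiles zero    = []
profiles (suc k) = deduplicate _≟ᵖ_ (filter (λ p → proj₁ p ≤? suc k)
  ((1 , 0 , 0) ∷ (cartesianProductWith _⊕ᵖ_ (profiles k) (profiles k) ++
                  cartesianProductWith _⊗ᵖ_ (profiles k) (profiles k))))

profile∈profiles : ∀ k a → order a ≤ k → profile a ∈ˡ profiles k
profile∈profiles zero    a le with () ← ≤-trans (1≤order a) le
profile∈profiles (suc k) a le =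
  ∈-deduplicate⁺ _≟ᵖ_ (∈-filter⁺ (λ p → proj₁ p ≤? suc k) (generated a le) le)
  where
  generated : ∀ a → order a ≤ suc k → profile a ∈ˡ
    ((1 , 0 , 0) ∷ (cartesianProductWith _⊕ᵖ_ (profiles k) (profiles k) ++
                    cartesianProductWith _⊗ᵖ_ (profiles k) (profiles k)))
  generated leaf    _  = here refl
  generated (a ⊕ b) le = there (∈-++⁺ˡ (∈-cartesianProductWith⁺ _⊕ᵖ_
    (profile∈profiles k a (≤-pred (≤-trans (m<m+n (order a) (1≤order b)) le)))
    (profile∈profiles k b (≤-pred (≤-trans (m<n+m (order b) (1≤order a)) le)))))
  generated (a ⊗ b) le = there (∈-++⁺ʳ (cartesianProductWith _⊕ᵖ_ (profiles k) (profiles k))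
    (∈-cartesianProductWith⁺ _⊗ᵖ_
    (profile∈profiles k a (≤-pred (≤-trans (m<m+n (order a) (1≤order b)) le)))
    (profile∈profiles k b (≤-pred (≤-trans (m<n+m (order b) (1≤order a)) le)))))

-- The profiles of K₁, K₂, K₃, K₂,₂, K₂,₃, K₂,₄; meaningless outside the orders 1 to 6.
best : ℕ → Profile
best 2 = 2 , 1 , 2
best 3 = 3 , 4 , 9
best 4 = 4 , 9 , 24
best 5 = 5 , 21 , 64
best 6 = 6 , 45 , 156
best n = 1 , 0 , 0

-- Equality of profiles is what fixes the mean of K₁ ∪ Q, since it depends on the number of
-- connected sets as well as on the mean of Q.
best-unique : ∀ q → order q ≤ 6 → best (order q) ≼ᵖ profile q → profile q ≡ best (order q)
best-unique q le = All.lookup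
  (from-yes (All.all? (λ p → (best (proj₁ p) ≼ᵖ? p) →-dec (p ≟ᵖ best (proj₁ p))) (profiles 6)))
  (profile∈profiles 6 q le)

isolated-best : ∀ a b → order a + order b ≤ 7 →
  (profile a ⊕ᵖ profile b) ≼ᵖ ((1 , 0 , 0) ⊕ᵖ best (order a + order b ∸ 1))
isolated-best a b le = All.lookup (from-yes
  (All.all? (λ pq → isolated-best? (proj₁ pq) (proj₂ pq)) (cartesianProduct (profiles 6) (profiles 6))))
    (∈-cartesianProduct⁺
      (profile∈profiles 6 a (≤-pred (≤-trans (m<m+n (order a) (1≤order b)) le)))
      (profile∈profiles 6 b (≤-pred (≤-trans (m<n+m (order b) (1≤order a)) le)))) le
  where
  isolated-best? : ∀ p q → Dec (proj₁ p + proj₁ q ≤ 7 →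
    (p ⊕ᵖ q) ≼ᵖ ((1 , 0 , 0) ⊕ᵖ best (proj₁ p + proj₁ q ∸ 1)))
  isolated-best? p q = (proj₁ p + proj₁ q ≤? 7) →-dec
    ((p ⊕ᵖ q) ≼ᵖ? ((1 , 0 , 0) ⊕ᵖ best (proj₁ p + proj₁ q ∸ 1)))

small-order : ∀ m a b q → m ≤ 6 → order a + order b ≡ suc m → order q ≡ m →
  best m ≼ᵖ profile q → (a ⊕ b) ≼ (leaf ⊕ q)
small-order m a b q m≤6 eq refl le =
  subst (λ p → (profile a ⊕ᵖ profile b) ≼ᵖ ((1 , 0 , 0) ⊕ᵖ p)) (sym (best-unique q m≤6 le))
    (subst (λ n → (profile a ⊕ᵖ profile b) ≼ᵖ ((1 , 0 , 0) ⊕ᵖ best (n ∸ 1))) eq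
      (isolated-best a b (≤-trans (≤-reflexive eq) (s≤s m≤6))))

-- Counting connected sets

bit : Bool → ℕ
bit b = if b then 1 else 0

length-filter : ∀ {A : Set} {P : Pred A 0ℓ} (P? : Decidable P) xs →
  length (filter P? xs) ≡ sum (map (λ x → bit (does (P? x))) xs)
length-filter P? []       = refl
length-filter P? (x ∷ xs) with does (P? x)
... | true  = cong suc (length-filter P? xs)
... | false = length-filter P? xs

-- The sum is relative to a vertex subset of a fixed ambient graph, so the parts of a decomposition
-- are handled without forming induced subgraphs.
ΣSub : Subset n → (Subset n → ℕ) → ℕ
ΣSub []            f = f []
ΣSub (inside  ∷ U) f = ΣSub U (f ∘ (inside ∷_)) + ΣSub U (f ∘ (outside ∷_))
ΣSub (outside ∷ U) f = ΣSub U (f ∘ (outside ∷_))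

sum-subsets : ∀ n (f : Subset n → ℕ) → sum (map f (subsets n)) ≡ ΣSub ⊤ f
sum-subsets zero    f = +-identityʳ (f [])
sum-subsets (suc n) f = begin
  sum (map f (map (inside ∷_) (subsets n) ++ map (outside ∷_) (subsets n)))
    ≡⟨ cong sum (map-++ f (map (inside ∷_) (subsets n)) (map (outside ∷_) (subsets n))) ⟩
  sum (map f (map (inside ∷_) (subsets n)) ++ map f (map (outside ∷_) (subsets n)))
    ≡⟨ sum-++ (map f (map (inside ∷_) (subsets n))) _ ⟩
  sum (map f (map (inside ∷_) (subsets n))) + sum (map f (map (outside ∷_) (subsets n)))
    ≡⟨ cong₂ (λ xs ys → sum xs + sum ys) (map-∘ (subsets n)) (map-∘ (subsets n)) ⟨
  sum (map (f ∘ (inside ∷_)) (subsets n)) + sum (map (f ∘ (outside ∷_)) (subsets n))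
    ≡⟨ cong₂ _+_ (sum-subsets n _) (sum-subsets n _) ⟩
  ΣSub ⊤ f ∎
  where open ≡-Reasoning

module _ {A : Set} where

  sum-zero : (xs : List A) → sum (map (const 0) xs) ≡ 0
  sum-zero []       = refl
  sum-zero (_ ∷ xs) = sum-zero xs

  sum-+ : (f g : A → ℕ) (xs : List A) →
    sum (map f xs) + sum (map g xs) ≡ sum (map (λ x → f x + g x) xs)
  sum-+ f g []       = refl
  sum-+ f g (x ∷ xs) = trans (alg (f x) (sum (map f xs)) (g x) (sum (map g xs)))
                             (cong (f x + g x +_) (sum-+ f g xs))
    where
    alg : ∀ a b c d → a + b + (c + d) ≡ a + c + (b + d)
    alg = solve-∀

  sum-*ˡ : ∀ k (f : A → ℕ) (xs : List A) → k * sum (map f xs) ≡ sum (map (λ x → k * f x) xs)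
  sum-*ˡ k f []       = *-zeroʳ k
  sum-*ˡ k f (x ∷ xs) =
    trans (*-distribˡ-+ k (f x) (sum (map f xs))) (cong (k * f x +_) (sum-*ˡ k f xs))

  sum-cong : {f g : A → ℕ} → (∀ x → f x ≡ g x) → (xs : List A) → sum (map f xs) ≡ sum (map g xs)
  sum-cong eq []       = refl
  sum-cong eq (x ∷ xs) = cong₂ _+_ (eq x) (sum-cong eq xs)

  sum-swap : ∀ n (f : ℕ → ℕ) (p : ℕ → A → ℕ) (xs : List A) →
    sum (applyUpTo (λ i → f i * sum (map (p i) xs)) n) ≡
    sum (map (λ x → sum (applyUpTo (λ i → f i * p i x) n)) xs)
  sum-swap zero    f p xs = sym (sum-zero xs)
  sum-swap (suc n) f p xs = begin
    f 0 * sum (map (p 0) xs) + sum (applyUpTo (λ i → f (suc i) * sum (map (p (suc i)) xs)) n)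
      ≡⟨ cong₂ _+_ (sum-*ˡ (f 0) (p 0) xs) (sum-swap n (f ∘ suc) (p ∘ suc) xs) ⟩
    sum (map (λ x → f 0 * p 0 x) xs)
      + sum (map (λ x → sum (applyUpTo (λ i → f (suc i) * p (suc i) x) n)) xs)
      ≡⟨ sum-+ _ _ xs ⟩
    sum (map (λ x → sum (applyUpTo (λ i → f i * p i x) (suc n))) xs) ∎
    where open ≡-Reasoning

sum-applyUpTo-0 : ∀ n (f : ℕ → ℕ) → (∀ i → f i ≡ 0) → sum (applyUpTo f n) ≡ 0
sum-applyUpTo-0 zero    f eq = refl
sum-applyUpTo-0 (suc n) f eq = cong₂ _+_ (eq 0) (sum-applyUpTo-0 n (f ∘ suc) (eq ∘ suc))

sum-δ : ∀ {n k} → k < n → (f : ℕ → ℕ) → sum (applyUpTo (λ i → f i * bit (k ≡ᵇ i)) n) ≡ f k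
sum-δ {suc n} {zero}  _         f = trans
  (cong₂ _+_ (*-identityʳ (f 0)) (sum-applyUpTo-0 n _ (λ i → *-zeroʳ (f (suc i)))))
  (+-identityʳ (f 0))
sum-δ {suc n} {suc k} (s≤s k<n) f = cong₂ _+_ (*-zeroʳ (f 0)) (sum-δ k<n (f ∘ suc))

module _ (G : Graph n) where

  connected : Subset n → ℕ
  connected S = bit (does (inducesConnected? G S))

  connected-yes : ∀ {S} → InducesConnected G S → connected S ≡ 1
  connected-yes {S} c = cong bit (dec-true (inducesConnected? G S) c)

  connected-no : ∀ {S} → ¬ InducesConnected G S → connected S ≡ 0
  connected-no {S} c = cong bit (dec-false (inducesConnected? G S) c)

  weight : (ℕ → ℕ) → Subset n → ℕ
  weight f S = connected S * f ∣ S ∣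

0<∣_∣ : ∀ {S : Subset n} → Nonempty S → 0 < ∣ S ∣
0<∣_∣ {S = inside  ∷ S} _                 = s≤s z≤n
0<∣_∣ {S = outside ∷ S} (suc x , there x∈) = 0<∣ x , x∈ ∣

-- Exchanging the sums counts each connected set once, at its own size. That size lies between 1 and
-- n because connected sets are nonempty. `const 1` and `id` yield the value and the derivative of Φ
-- at 1.
sum-a : (G : Graph n) (f : ℕ → ℕ) →
  sum (applyUpTo (λ i → f (suc i) * a (suc i) G) n) ≡ ΣSub ⊤ (weight G f)
sum-a {n} G f = begin
  sum (applyUpTo (λ i → f (suc i) * a (suc i) G) n)
    ≡⟨ applyUpTo-cong n (λ i → cong (f (suc i) *_) (length-filter (sized? i) (subsets n))) ⟩
  sum (applyUpTo (λ i → f (suc i) * sum (map (λ S → bit (does (sized? i S))) (subsets n))) n)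
    ≡⟨ sum-swap n (f ∘ suc) (λ i S → bit (does (sized? i S))) (subsets n) ⟩
  sum (map (λ S → sum (applyUpTo (λ i → f (suc i) * bit (does (sized? i S))) n)) (subsets n))
    ≡⟨ sum-cong pointwise (subsets n) ⟩
  sum (map (weight G f) (subsets n))
    ≡⟨ sum-subsets n (weight G f) ⟩
  ΣSub ⊤ (weight G f) ∎
  where
  open ≡-Reasoning
  sized? : ∀ i S → Dec (∣ S ∣ ≡ suc i × InducesConnected G S)
  sized? i S = (∣ S ∣ ≟ suc i) ×-dec inducesConnected? G S
  applyUpTo-cong : ∀ n {f g : ℕ → ℕ} → (∀ i → f i ≡ g i) → sum (applyUpTo f n) ≡ sum (applyUpTo g n)
  applyUpTo-cong zero    eq = refl
  applyUpTo-cong (suc n) eq = cong₂ _+_ (eq 0) (applyUpTo-cong n (eq ∘ suc))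
  pointwise : ∀ S → sum (applyUpTo (λ i → f (suc i) * bit (does (sized? i S))) n) ≡ weight G f S
  pointwise S = by-cases (inducesConnected? G S)
    where
    by-cases : (c? : Dec (InducesConnected G S)) →
      sum (applyUpTo (λ i → f (suc i) * bit ((∣ S ∣ ≡ᵇ suc i) ∧ does c?)) n) ≡ bit (does c?) * f ∣ S ∣
    by-cases (no _)  = sum-applyUpTo-0 n _ (λ i →
      trans (cong (λ b → f (suc i) * bit b) (∧-zeroʳ (∣ S ∣ ≡ᵇ suc i))) (*-zeroʳ (f (suc i))))
    by-cases (yes c) = trans (nonzero ∣ S ∣ 0<∣ proj₁ c ∣ (∣p∣≤n S)) (sym (+-identityʳ (f ∣ S ∣)))
      where
      nonzero : ∀ k → 0 < k → k ≤ n →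
        sum (applyUpTo (λ i → f (suc i) * bit ((k ≡ᵇ suc i) ∧ true)) n) ≡ f k
      nonzero (suc k) _ k<n = trans
        (applyUpTo-cong n (λ i → cong (λ b → f (suc i) * bit b) (∧-identityʳ (k ≡ᵇ i))))
        (sum-δ k<n (f ∘ suc))

eval-1 : ∀ p → eval p 1 ≡ sum p
eval-1 []      = refl
eval-1 (c ∷ p) = cong (c +_) (trans (+-identityʳ (eval p 1)) (eval-1 p))

sum-zipWith-applyUpTo : ∀ n (f g k : ℕ → ℕ) →
  sum (zipWith _*_ (applyUpTo f (length (map g (applyUpTo k n)))) (map g (applyUpTo k n))) ≡
  sum (applyUpTo (λ i → f i * g (k i)) n)
sum-zipWith-applyUpTo zero    f g k = refl
sum-zipWith-applyUpTo (suc n) f g k =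
  cong (f 0 * g (k 0) +_) (sum-zipWith-applyUpTo n (f ∘ suc) g (k ∘ suc))

sum-map-applyUpTo : ∀ n (g k : ℕ → ℕ) →
  sum (map g (applyUpTo k n)) ≡ sum (applyUpTo (λ i → 1 * g (k i)) n)
sum-map-applyUpTo zero    g k = refl
sum-map-applyUpTo (suc n) g k =
  cong₂ _+_ (sym (*-identityˡ (g (k 0)))) (sum-map-applyUpTo n g (k ∘ suc))

Φ[1] : (G : Graph n) → eval (Φ G) 1 ≡ ΣSub ⊤ (weight G (const 1))
Φ[1] {n} G = begin
  eval (Φ G) 1                                       ≡⟨ eval-1 (Φ G) ⟩
  sum (map (λ i → a (suc i) G) (upTo n))             ≡⟨ sum-map-applyUpTo n _ id ⟩
  sum (applyUpTo (λ i → 1 * a (suc i) G) n)          ≡⟨ sum-a G (const 1) ⟩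
  ΣSub ⊤ (weight G (const 1))                        ∎
  where open ≡-Reasoning

Φ′[1] : (G : Graph n) → eval (derivative (Φ G)) 1 ≡ ΣSub ⊤ (weight G id)
Φ′[1] {n} G = begin
  eval (derivative (Φ G)) 1                          ≡⟨ eval-1 (derivative (Φ G)) ⟩
  -- `drop 1` removes the product at index 0, so the multipliers that remain start at 1, whence
  -- `suc`.
  sum (derivative (Φ G))                             ≡⟨ sum-zipWith-applyUpTo n suc _ id ⟩
  sum (applyUpTo (λ i → suc i * a (suc i) G) n)      ≡⟨ sum-a G id ⟩
  ΣSub ⊤ (weight G id)                               ∎
  where open ≡-Reasoning

-- Sums over subsets and partitions

ΣSub-cong : (U : Subset n) {f g : Subset n → ℕ} → (∀ {S} → S ⊆ U → f S ≡ g S) → ΣSub U f ≡ ΣSub U g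
ΣSub-cong []            eq = eq ⊆-refl
ΣSub-cong (inside  ∷ U) eq =
  cong₂ _+_ (ΣSub-cong U (λ S⊆U → eq (s⊆s S⊆U))) (ΣSub-cong U (λ S⊆U → eq (out S⊆U)))
  where
  out : ∀ {S} → S ⊆ U → (outside ∷ S) ⊆ (inside ∷ U)
  out S⊆U (there x∈) = there (S⊆U x∈)
ΣSub-cong (outside ∷ U) eq = ΣSub-cong U (λ S⊆U → eq (s⊆s S⊆U))

ΣSub-+ : (U : Subset n) (f g : Subset n → ℕ) → ΣSub U (λ S → f S + g S) ≡ ΣSub U f + ΣSub U g
ΣSub-+ []            f g = refl
ΣSub-+ (outside ∷ U) f g = ΣSub-+ U (f ∘ (outside ∷_)) (g ∘ (outside ∷_))
ΣSub-+ (inside  ∷ U) f g = trans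
  (cong₂ _+_ (ΣSub-+ U (f ∘ (inside ∷_)) (g ∘ (inside ∷_)))
             (ΣSub-+ U (f ∘ (outside ∷_)) (g ∘ (outside ∷_))))
  (alg (ΣSub U (f ∘ (inside ∷_))) (ΣSub U (g ∘ (inside ∷_)))
       (ΣSub U (f ∘ (outside ∷_))) (ΣSub U (g ∘ (outside ∷_))))
  where
  alg : ∀ a b c d → a + b + (c + d) ≡ a + c + (b + d)
  alg = solve-∀

ΣSub-*ˡ : (U : Subset n) (k : ℕ) (f : Subset n → ℕ) → ΣSub U (λ S → k * f S) ≡ k * ΣSub U f
ΣSub-*ˡ []            k f = refl
ΣSub-*ˡ (outside ∷ U) k f = ΣSub-*ˡ U k (f ∘ (outside ∷_))
ΣSub-*ˡ (inside  ∷ U) k f = trans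
  (cong₂ _+_ (ΣSub-*ˡ U k (f ∘ (inside ∷_))) (ΣSub-*ˡ U k (f ∘ (outside ∷_))))
  (sym (*-distribˡ-+ k _ _))

ΣSub-product : (A B : Subset n) (f g : Subset n → ℕ) →
  ΣSub A (λ S → ΣSub B (λ T → f S * g T)) ≡ ΣSub A f * ΣSub B g
ΣSub-product A B f g = begin
  ΣSub A (λ S → ΣSub B (λ T → f S * g T))
    ≡⟨ ΣSub-cong A (λ {S} _ → trans (ΣSub-*ˡ B (f S) g) (*-comm (f S) (ΣSub B g))) ⟩
  ΣSub A (λ S → ΣSub B g * f S)             ≡⟨ ΣSub-*ˡ A (ΣSub B g) f ⟩
  ΣSub B g * ΣSub A f                       ≡⟨ *-comm (ΣSub B g) (ΣSub A f) ⟩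
  ΣSub A f * ΣSub B g                       ∎
  where open ≡-Reasoning

ΣSub-⊥ : (f : Subset n → ℕ) → ΣSub ⊥ f ≡ f ⊥
ΣSub-⊥ {zero}  f = refl
ΣSub-⊥ {suc n} f = ΣSub-⊥ (f ∘ (outside ∷_))

ΣSub-⁅⁆ : (x : Fin n) (f : Subset n → ℕ) → ΣSub ⁅ x ⁆ f ≡ f ⁅ x ⁆ + f ⊥
ΣSub-⁅⁆ zero    f = cong₂ _+_ (ΣSub-⊥ (f ∘ (inside ∷_))) (ΣSub-⊥ (f ∘ (outside ∷_)))
ΣSub-⁅⁆ (suc x) f = ΣSub-⁅⁆ x (f ∘ (outside ∷_))

-- Inductive rather than a conjunction of disjointness and covering, so that sums and cardinalities
-- split by structural recursion.
data Partition : Subset n → Subset n → Subset n → Set where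
  []    : Partition [] [] []
  left  : {U A B : Subset n} → Partition U A B → Partition (inside ∷ U) (inside ∷ A) (outside ∷ B)
  right : {U A B : Subset n} → Partition U A B → Partition (inside ∷ U) (outside ∷ A) (inside ∷ B)
  neither  : {U A B : Subset n} → Partition U A B →
    Partition (outside ∷ U) (outside ∷ A) (outside ∷ B)

module _ where
  private
    variable
      U A B S T : Subset n

  ΣSub-Partition : Partition U A B → (f : Subset n → ℕ) →
    ΣSub U f ≡ ΣSub A (λ S → ΣSub B (λ T → f (S ∪ˢ T)))
  ΣSub-Partition []        f = refl
  ΣSub-Partition (left p)  f =
    cong₂ _+_ (ΣSub-Partition p (f ∘ (inside ∷_))) (ΣSub-Partition p (f ∘ (outside ∷_)))
  ΣSub-Partition (right {A = A} p) f = trans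
    (cong₂ _+_ (ΣSub-Partition p (f ∘ (inside ∷_))) (ΣSub-Partition p (f ∘ (outside ∷_))))
    (sym (ΣSub-+ A _ _))
  ΣSub-Partition (neither p)  f = ΣSub-Partition p (f ∘ (outside ∷_))

  ∣∣-Partition : Partition U A B → ∣ U ∣ ≡ ∣ A ∣ + ∣ B ∣
  ∣∣-Partition []          = refl
  ∣∣-Partition (left p)    = cong suc (∣∣-Partition p)
  ∣∣-Partition (right {A = A} {B = B} p) =
    trans (cong suc (∣∣-Partition p)) (sym (+-suc ∣ A ∣ ∣ B ∣))
  ∣∣-Partition (neither p) = ∣∣-Partition p

  ∪-Partition : Partition U A B → S ⊆ A → T ⊆ B → Partition (S ∪ˢ T) S T
  ∪-Partition {S = []}    {T = []}    []       _ _ = []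
  ∪-Partition {S = s ∷ S} {T = inside ∷ T} (left p) _ T⊆ with () ← T⊆ here
  ∪-Partition {S = inside ∷ S} {T = outside ∷ T} (left p) S⊆ T⊆ =
    left (∪-Partition p (drop-∷-⊆ S⊆) (drop-∷-⊆ T⊆))
  ∪-Partition {S = outside ∷ S} {T = outside ∷ T} (left p) S⊆ T⊆ =
    neither (∪-Partition p (drop-∷-⊆ S⊆) (drop-∷-⊆ T⊆))
  ∪-Partition {S = inside ∷ S} {T = t ∷ T} (right p) S⊆ _ with () ← S⊆ here
  ∪-Partition {S = outside ∷ S} {T = inside ∷ T} (right p) S⊆ T⊆ =
    right (∪-Partition p (drop-∷-⊆ S⊆) (drop-∷-⊆ T⊆))
  ∪-Partition {S = outside ∷ S} {T = outside ∷ T} (right p) S⊆ T⊆ =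
    neither (∪-Partition p (drop-∷-⊆ S⊆) (drop-∷-⊆ T⊆))
  ∪-Partition {S = inside ∷ S} {T = t ∷ T} (neither p) S⊆ _ with () ← S⊆ here
  ∪-Partition {S = outside ∷ S} {T = inside ∷ T} (neither p) _ T⊆ with () ← T⊆ here
  ∪-Partition {S = outside ∷ S} {T = outside ∷ T} (neither p) S⊆ T⊆ =
    neither (∪-Partition p (drop-∷-⊆ S⊆) (drop-∷-⊆ T⊆))

  disjoint : Partition U A B → ∀ {x} → x ∈ A → x ∉ B
  disjoint (left p)    (there x∈A) (there x∈B) = disjoint p x∈A x∈B
  disjoint (right p)   (there x∈A) (there x∈B) = disjoint p x∈A x∈B
  disjoint (neither p) (there x∈A) (there x∈B) = disjoint p x∈A x∈B

empty nonempty : Subset n → ℕ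
empty []            = 1
empty (inside  ∷ _) = 0
empty (outside ∷ S) = empty S
nonempty []            = 0
nonempty (inside  ∷ _) = 1
nonempty (outside ∷ S) = nonempty S

empty-⊥ : ∀ n → empty (⊥ {n}) ≡ 1
empty-⊥ zero    = refl
empty-⊥ (suc n) = empty-⊥ n

nonempty-⊥ : ∀ n → nonempty (⊥ {n}) ≡ 0
nonempty-⊥ zero    = refl
nonempty-⊥ (suc n) = nonempty-⊥ n

empty-Nonempty : {S : Subset n} → Nonempty S → empty S ≡ 0
empty-Nonempty {S = inside  ∷ S} _                 = refl
empty-Nonempty {S = outside ∷ S} (suc x , there x∈) = empty-Nonempty (x , x∈)

nonempty-Nonempty : {S : Subset n} → Nonempty S → nonempty S ≡ 1
nonempty-Nonempty {S = inside  ∷ S} _                 = refl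
nonempty-Nonempty {S = outside ∷ S} (suc x , there x∈) = nonempty-Nonempty (x , x∈)

⊥-or-Nonempty : (S : Subset n) → S ≡ ⊥ ⊎ Nonempty S
⊥-or-Nonempty S with nonempty? S
... | yes ne = inj₂ ne
... | no ¬ne = inj₁ (Empty-unique ¬ne)

ΣSub-0 : (U : Subset n) → ΣSub U (const 0) ≡ 0
ΣSub-0 U = ΣSub-*ˡ U 0 (const 0)

ΣSub-1 : (U : Subset n) → ΣSub U (const 1) ≡ suc (nonempties ∣ U ∣)
ΣSub-1 []            = refl
ΣSub-1 (outside ∷ U) = ΣSub-1 U
ΣSub-1 (inside  ∷ U) rewrite ΣSub-1 U = cong suc (+-suc _ _)

ΣSub-empty : (U : Subset n) → ΣSub U empty ≡ 1
ΣSub-empty []            = refl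
ΣSub-empty (outside ∷ U) = ΣSub-empty U
ΣSub-empty (inside  ∷ U) = cong₂ _+_ (ΣSub-0 U) (ΣSub-empty U)

ΣSub-nonempty : (U : Subset n) → ΣSub U nonempty ≡ nonempties ∣ U ∣
ΣSub-nonempty []            = refl
ΣSub-nonempty (outside ∷ U) = ΣSub-nonempty U
ΣSub-nonempty (inside  ∷ U) = cong₂ _+_ (ΣSub-1 U) (ΣSub-nonempty U)

ΣSub-∣∣ : (U : Subset n) → ΣSub U ∣_∣ ≡ totalSize ∣ U ∣
ΣSub-∣∣ []            = refl
ΣSub-∣∣ (outside ∷ U) = ΣSub-∣∣ U
ΣSub-∣∣ (inside  ∷ U) = cong₂ _+_
  (trans (ΣSub-+ U (const 1) ∣_∣) (trans (cong₂ _+_ (ΣSub-1 U) (ΣSub-∣∣ U)) (+-comm _ (totalSize ∣ U ∣))))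
  (ΣSub-∣∣ U)

nonempty*∣∣ : (S : Subset n) → nonempty S * ∣ S ∣ ≡ ∣ S ∣
nonempty*∣∣ []            = refl
nonempty*∣∣ (inside  ∷ S) = *-identityˡ _
nonempty*∣∣ (outside ∷ S) = nonempty*∣∣ S

-- Connected sets along a cotree

module _ (G : Graph n) where
  open Graph G

  Anticomplete FullyJoined : Subset n → Subset n → Set
  Anticomplete A B = ∀ {x y} → x ∈ A → y ∈ B → ¬ x ~ y
  FullyJoined  A B = ∀ {x y} → x ∈ A → y ∈ B → x ~ y

  ¬connected-⊥ : ¬ InducesConnected G ⊥
  ¬connected-⊥ ((x , x∈⊥) , _) = ∉⊥ x∈⊥

  anticomplete⇒¬connected : ∀ {U A B S T} → Partition U A B → Anticomplete A B → S ⊆ A → T ⊆ B →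
    Nonempty S → Nonempty T → ¬ InducesConnected G (S ∪ˢ T)
  anticomplete⇒¬connected {A = A} {S = S} {T = T} p anti S⊆A T⊆B (x , x∈S) (y , y∈T) (_ , conn) =
    disjoint p (stays (conn x y (x∈p∪q⁺ (inj₁ x∈S)) (x∈p∪q⁺ (inj₂ y∈T))) (S⊆A x∈S)) (T⊆B y∈T)
    where
    stays : ∀ {x y} → Star (StepIn G (S ∪ˢ T)) x y → x ∈ A → y ∈ A
    stays ε x∈A = x∈A
    stays ((_ , z∈ , x~z) ◅ rest) x∈A with x∈p∪q⁻ S T z∈
    ... | inj₁ z∈S = stays rest (S⊆A z∈S)
    ... | inj₂ z∈T = contradiction x~z (anti x∈A (T⊆B z∈T))

  fullyJoined⇒connected : ∀ {S T} → FullyJoined S T → Nonempty S → Nonempty T →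
    InducesConnected G (S ∪ˢ T)
  fullyJoined⇒connected {S} {T} full (s , s∈S) (t , t∈T) = (s , inS s∈S) , walk
    where
    inS : ∀ {x} → x ∈ S → x ∈ S ∪ˢ T
    inS x∈S = x∈p∪q⁺ (inj₁ x∈S)
    inT : ∀ {x} → x ∈ T → x ∈ S ∪ˢ T
    inT x∈T = x∈p∪q⁺ (inj₂ x∈T)
    down : ∀ {x y} → x ∈ S → y ∈ T → StepIn G (S ∪ˢ T) x y
    down x∈S y∈T = inS x∈S , inT y∈T , full x∈S y∈T
    up : ∀ {x y} → x ∈ S → y ∈ T → StepIn G (S ∪ˢ T) y x
    up x∈S y∈T = inT y∈T , inS x∈S , ~-sym (full x∈S y∈T)
    walk : ∀ x y → x ∈ S ∪ˢ T → y ∈ S ∪ˢ T → Star (StepIn G (S ∪ˢ T)) x y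
    walk x y x∈ y∈ with x∈p∪q⁻ S T x∈ | x∈p∪q⁻ S T y∈
    ... | inj₁ x∈S | inj₁ y∈S = down x∈S t∈T ◅ up y∈S t∈T ◅ ε
    ... | inj₁ x∈S | inj₂ y∈T = down x∈S y∈T ◅ ε
    ... | inj₂ x∈T | inj₁ y∈S = up y∈S x∈T ◅ ε
    ... | inj₂ x∈T | inj₂ y∈T = up s∈S x∈T ◅ down s∈S y∈T ◅ ε

  data Decomposes : Subset n → Cotree → Set where
    leaf  : ∀ x → Decomposes ⁅ x ⁆ leaf
    union : ∀ {U A B a b} → Partition U A B → Anticomplete A B →
            Decomposes A a → Decomposes B b → Decomposes U (a ⊕ b)
    join  : ∀ {U A B a b} → Partition U A B → FullyJoined A B →
            Decomposes A a → Decomposes B b → Decomposes U (a ⊗ b)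

  ∣∣-Decomposes : ∀ {U a} → Decomposes U a → ∣ U ∣ ≡ order a
  ∣∣-Decomposes (leaf x)        = ∣⁅x⁆∣≡1 x
  ∣∣-Decomposes (union p _ d e) =
    trans (∣∣-Partition p) (cong₂ _+_ (∣∣-Decomposes d) (∣∣-Decomposes e))
  ∣∣-Decomposes (join p _ d e)  =
    trans (∣∣-Partition p) (cong₂ _+_ (∣∣-Decomposes d) (∣∣-Decomposes e))

  weight-⊥ : ∀ f → weight G f ⊥ ≡ 0
  weight-⊥ f = cong (_* f ∣ ⊥ {n} ∣) (connected-no G ¬connected-⊥)

  module _ (f : ℕ → ℕ) {U A B : Subset n} (p : Partition U A B)
           (crossing : ℕ)
           (cross : ∀ {S T} → S ⊆ A → T ⊆ B → Nonempty S → Nonempty T → connected G (S ∪ˢ T) ≡ crossing)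
           where

    -- `crossing` is 0 across a disjoint union and 1 across a join, so one computation serves both.
    -- The factors `empty` and `nonempty` encode the cases as products, which lets the double sum
    -- factor.
    weight-split : ∀ {S T} → S ⊆ A → T ⊆ B → weight G f (S ∪ˢ T) ≡
      crossing * (nonempty S * nonempty T * f (∣ S ∣ + ∣ T ∣)) + (weight G f S * empty T + empty S * weight G f T)
    weight-split {S} {T} S⊆A T⊆B with ⊥-or-Nonempty S | ⊥-or-Nonempty T
    ... | inj₁ refl | _
      rewrite nonempty-⊥ n | empty-⊥ n | weight-⊥ f | ∪-identityˡ T | *-zeroʳ crossing = sym (*-identityˡ _)
    ... | inj₂ neS | inj₁ refl
      rewrite nonempty-Nonempty neS | empty-Nonempty neS | nonempty-⊥ n | empty-⊥ n
            | ∪-identityʳ S | *-zeroʳ crossing = alg _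
      where
      alg : ∀ w → w ≡ w * 1 + 0
      alg = solve-∀
    ... | inj₂ neS | inj₂ neT
      rewrite nonempty-Nonempty neS | empty-Nonempty neS | nonempty-Nonempty neT | empty-Nonempty neT
            | cross S⊆A T⊆B neS neT | ∣∣-Partition (∪-Partition p S⊆A T⊆B) =
      alg crossing (f (∣ S ∣ + ∣ T ∣)) (weight G f S)
      where
      alg : ∀ c w v → c * w ≡ c * (w + 0) + (v * 0 + 0)
      alg = solve-∀

    ΣSub-split : ΣSub U (weight G f) ≡
      crossing * ΣSub A (λ S → ΣSub B (λ T → nonempty S * nonempty T * f (∣ S ∣ + ∣ T ∣)))
      + (ΣSub A (weight G f) + ΣSub B (weight G f))
    ΣSub-split = begin
      ΣSub U (weight G f)                                       ≡⟨ ΣSub-Partition p _ ⟩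
      ΣSub A (λ S → ΣSub B (λ T → weight G f (S ∪ˢ T)))
        ≡⟨ ΣSub-cong A (λ {S} S⊆A → trans (ΣSub-cong B (weight-split S⊆A))
             (trans (ΣSub-+ B _ _) (cong₂ _+_ (ΣSub-*ˡ B crossing _) (ΣSub-+ B _ _)))) ⟩
      ΣSub A (λ S → crossing * ΣSub B (J S) + (ΣSub B (λ T → w S * empty T) + ΣSub B (λ T → empty S * w T)))
        ≡⟨ trans (ΣSub-+ A _ _) (cong₂ _+_ (ΣSub-*ˡ A crossing _) (ΣSub-+ A _ _)) ⟩
      crossing * ΣSub A (λ S → ΣSub B (J S)) +
        (ΣSub A (λ S → ΣSub B (λ T → w S * empty T)) + ΣSub A (λ S → ΣSub B (λ T → empty S * w T)))
        ≡⟨ cong (crossing * ΣSub A (λ S → ΣSub B (J S)) +_) (cong₂ _+_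
             (trans (ΣSub-product A B w empty) (trans (cong (ΣSub A w *_) (ΣSub-empty B)) (*-identityʳ _)))
             (trans (ΣSub-product A B empty w) (trans (cong (_* ΣSub B w) (ΣSub-empty A)) (*-identityˡ _)))) ⟩
      crossing * ΣSub A (λ S → ΣSub B (J S)) + (ΣSub A w + ΣSub B w) ∎
      where
      open ≡-Reasoning
      w = weight G f
      J : Subset n → Subset n → ℕ
      J S T = nonempty S * nonempty T * f (∣ S ∣ + ∣ T ∣)

  ΣSub-crossing-1 : (A B : Subset n) →
    ΣSub A (λ S → ΣSub B (λ T → nonempty S * nonempty T * 1)) ≡ nonempties ∣ A ∣ * nonempties ∣ B ∣
  ΣSub-crossing-1 A B = begin
    ΣSub A (λ S → ΣSub B (λ T → nonempty S * nonempty T * 1))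
      ≡⟨ ΣSub-cong A (λ {S} _ → ΣSub-cong B (λ {T} _ → *-identityʳ (nonempty S * nonempty T))) ⟩
    ΣSub A (λ S → ΣSub B (λ T → nonempty S * nonempty T)) ≡⟨ ΣSub-product A B nonempty nonempty ⟩
    ΣSub A nonempty * ΣSub B nonempty
      ≡⟨ cong₂ _*_ (ΣSub-nonempty A) (ΣSub-nonempty B) ⟩
    nonempties ∣ A ∣ * nonempties ∣ B ∣                   ∎
    where open ≡-Reasoning

  ΣSub-crossing-size : (A B : Subset n) →
    ΣSub A (λ S → ΣSub B (λ T → nonempty S * nonempty T * (∣ S ∣ + ∣ T ∣))) ≡
    totalSize ∣ A ∣ * nonempties ∣ B ∣ + nonempties ∣ A ∣ * totalSize ∣ B ∣
  ΣSub-crossing-size A B = begin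
    ΣSub A (λ S → ΣSub B (λ T → nonempty S * nonempty T * (∣ S ∣ + ∣ T ∣)))
      ≡⟨ ΣSub-cong A (λ {S} _ → trans (ΣSub-cong B (λ {T} _ → pointwise S T)) (ΣSub-+ B _ _)) ⟩
    ΣSub A (λ S → ΣSub B (λ T → ∣ S ∣ * nonempty T) + ΣSub B (λ T → nonempty S * ∣ T ∣))
      ≡⟨ ΣSub-+ A _ _ ⟩
    ΣSub A (λ S → ΣSub B (λ T → ∣ S ∣ * nonempty T)) + ΣSub A (λ S → ΣSub B (λ T → nonempty S * ∣ T ∣))
      ≡⟨ cong₂ _+_ (trans (ΣSub-product A B ∣_∣ nonempty) (cong₂ _*_ (ΣSub-∣∣ A) (ΣSub-nonempty B)))
                   (trans (ΣSub-product A B nonempty ∣_∣) (cong₂ _*_ (ΣSub-nonempty A) (ΣSub-∣∣ B))) ⟩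
    totalSize ∣ A ∣ * nonempties ∣ B ∣ + nonempties ∣ A ∣ * totalSize ∣ B ∣ ∎
    where
    open ≡-Reasoning
    alg : ∀ a b c d → a * b * (c + d) ≡ (a * c) * b + a * (b * d)
    alg = solve-∀
    pointwise : ∀ S T →
      nonempty S * nonempty T * (∣ S ∣ + ∣ T ∣) ≡ ∣ S ∣ * nonempty T + nonempty S * ∣ T ∣
    pointwise S T = trans (alg (nonempty S) (nonempty T) ∣ S ∣ ∣ T ∣)
      (cong₂ (λ x y → x * nonempty T + nonempty S * y) (nonempty*∣∣ S) (nonempty*∣∣ T))

  ΣSub-leaf : ∀ f x → ΣSub ⁅ x ⁆ (weight G f) ≡ f 1
  ΣSub-leaf f x = begin
    ΣSub ⁅ x ⁆ (weight G f)            ≡⟨ ΣSub-⁅⁆ x (weight G f) ⟩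
    weight G f ⁅ x ⁆ + weight G f ⊥    ≡⟨ cong₂ _+_
      (cong₂ (λ c k → c * f k) (connected-yes G (singleton-connected G x)) (∣⁅x⁆∣≡1 x)) (weight-⊥ f) ⟩
    1 * f 1 + 0                        ≡⟨ trans (+-identityʳ _) (*-identityˡ _) ⟩
    f 1                                ∎
    where open ≡-Reasoning

  union-cross : ∀ {U A B S T} → Partition U A B → Anticomplete A B → S ⊆ A → T ⊆ B →
    Nonempty S → Nonempty T → connected G (S ∪ˢ T) ≡ 0
  union-cross p anti S⊆A T⊆B neS neT =
    connected-no G (anticomplete⇒¬connected p anti S⊆A T⊆B neS neT)

  join-cross : ∀ {A B S T} → FullyJoined A B → S ⊆ A → T ⊆ B →
    Nonempty S → Nonempty T → connected G (S ∪ˢ T) ≡ 1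
  join-cross full S⊆A T⊆B neS neT =
    connected-yes G (fullyJoined⇒connected (λ x∈S y∈T → full (S⊆A x∈S) (T⊆B y∈T)) neS neT)

  count-Decomposes : ∀ {U a} → Decomposes U a → ΣSub U (weight G (const 1)) ≡ #conn a
  count-Decomposes (leaf x) = ΣSub-leaf (const 1) x
  count-Decomposes (union {A = A} {B} {a} {b} p anti d e) = begin
    _ ≡⟨ ΣSub-split (const 1) p 0 (union-cross p anti) ⟩
    ΣSub A (weight G (const 1)) + ΣSub B (weight G (const 1))
      ≡⟨ cong₂ _+_ (count-Decomposes d) (count-Decomposes e) ⟩
    #conn a + #conn b      ≡⟨ #conn-⊕ a b ⟨
    #conn (a ⊕ b)          ∎
    where open ≡-Reasoning
  count-Decomposes (join {A = A} {B} {a} {b} p full d e) = begin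
    _ ≡⟨ ΣSub-split (const 1) p 1 (join-cross full) ⟩
    1 * ΣSub A (λ S → ΣSub B (λ T → nonempty S * nonempty T * 1)) +
      (ΣSub A (weight G (const 1)) + ΣSub B (weight G (const 1)))
      ≡⟨ cong₂ (λ c s → 1 * c + s) (trans (ΣSub-crossing-1 A B)
           (cong₂ (λ s t → nonempties s * nonempties t) (∣∣-Decomposes d) (∣∣-Decomposes e)))
           (cong₂ _+_ (count-Decomposes d) (count-Decomposes e)) ⟩
    1 * (nonempties (order a) * nonempties (order b)) + (#conn a + #conn b)
      ≡⟨ alg (nonempties (order a) * nonempties (order b)) (order a) (order b) (big a) (big b) ⟩
    #conn (a ⊗ b)          ∎
    where
    open ≡-Reasoning
    alg : ∀ z s t ra rb → 1 * z + ((s + ra) + (t + rb)) ≡ (s + t) + (z + (ra + rb))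
    alg = solve-∀

  sizeSum-Decomposes : ∀ {U a} → Decomposes U a → ΣSub U (weight G id) ≡ sizeSum a
  sizeSum-Decomposes (leaf x) = ΣSub-leaf id x
  sizeSum-Decomposes (union {A = A} {B} {a} {b} p anti d e) = begin
    _ ≡⟨ ΣSub-split id p 0 (union-cross p anti) ⟩
    ΣSub A (weight G id) + ΣSub B (weight G id)
      ≡⟨ cong₂ _+_ (sizeSum-Decomposes d) (sizeSum-Decomposes e) ⟩
    sizeSum a + sizeSum b   ≡⟨ alg (order a) (order b) (bigSize a) (bigSize b) ⟩
    sizeSum (a ⊕ b)         ∎
    where
    open ≡-Reasoning
    alg : ∀ s t wa wb → (s + wa) + (t + wb) ≡ (s + t) + (wa + wb)
    alg = solve-∀
  sizeSum-Decomposes (join {A = A} {B} {a} {b} p full d e) = begin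
    _ ≡⟨ ΣSub-split id p 1 (join-cross full) ⟩
    1 * ΣSub A (λ S → ΣSub B (λ T → nonempty S * nonempty T * (∣ S ∣ + ∣ T ∣))) +
      (ΣSub A (weight G id) + ΣSub B (weight G id))
      ≡⟨ cong₂ (λ c s → 1 * c + s)
           (trans (ΣSub-crossing-size A B) (cong₂ crossing (∣∣-Decomposes d) (∣∣-Decomposes e)))
           (cong₂ _+_ (sizeSum-Decomposes d) (sizeSum-Decomposes e)) ⟩
    1 * crossing (order a) (order b) + (sizeSum a + sizeSum b)
      ≡⟨ alg (crossing (order a) (order b)) (order a) (order b) (bigSize a) (bigSize b) ⟩
    sizeSum (a ⊗ b)        ∎
    where
    open ≡-Reasoning
    crossing : ℕ → ℕ → ℕ
    crossing s t = totalSize s * nonempties t + nonempties s * totalSize t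
    alg : ∀ z s t wa wb → 1 * z + ((s + wa) + (t + wb)) ≡ (s + t) + (z + (wa + wb))
    alg = solve-∀

-- Cographs decompose

complement : Graph n → Graph n
complement G = record
  { _~_      = λ x y → x ≢ y × ¬ x ~ y
  ; _~?_     = λ x y → ¬? (x Fin.≟ y) ×-dec ¬? (x ~? y)
  ; ~-sym    = λ { (x≢y , x≁y) → x≢y ∘ sym , x≁y ∘ ~-sym }
  ; ~-irrefl = λ { x≡y (x≢y , _) → x≢y x≡y }
  }
  where open Graph G

-- Distinctness of the four vertices is implied by the adjacencies: for instance a = c would make c
-- ~ d contradict the nonadjacency of a and d.
P₄-Free : Graph n → Set
P₄-Free G = ∀ {a b c d} → a ~ b → b ~ c → c ~ d → ¬ a ~ c → ¬ a ~ d → ¬ b ~ d → False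
  where open Graph G

cograph⇒P₄-free : (G : Graph n) → Cograph G → P₄-Free G
cograph⇒P₄-free {n} G cograph {a} {b} {c} {d} ab bc cd a≁c a≁d b≁d = cograph record
  { to        = to
  ; injective = λ {x} {y} → injective x y
  ; adjacency = λ x y → iff (agree x y)
  }
  where
  open Graph G
  to : Fin 4 → Fin n
  to 0F = a
  to 1F = b
  to 2F = c
  to 3F = d
  _~ₚ_  = Graph._~_ (path 4)
  _~ₚ?_ = Graph._~?_ (path 4)
  Agree : Fin 4 → Fin 4 → Set
  Agree x y = (x ~ₚ y × to x ~ to y) ⊎ (¬ (x ~ₚ y) × ¬ to x ~ to y)
  iff : ∀ {A B : Set} → (A × B) ⊎ (¬ A × ¬ B) → A ⇔ B
  iff (inj₁ (x , y)) = mk⇔ (const y) (const x)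
  iff (inj₂ (x , y)) = mk⇔ (λ z → contradiction z x) (λ z → contradiction z y)
  agree : ∀ x y → Agree x y
  agree 0F 0F = inj₂ (from-no (0F ~ₚ? 0F) , ~-irrefl refl)
  agree 0F 1F = inj₁ (from-yes (0F ~ₚ? 1F) , ab)
  agree 0F 2F = inj₂ (from-no (0F ~ₚ? 2F) , a≁c)
  agree 0F 3F = inj₂ (from-no (0F ~ₚ? 3F) , a≁d)
  agree 1F 0F = inj₁ (from-yes (1F ~ₚ? 0F) , ~-sym ab)
  agree 1F 1F = inj₂ (from-no (1F ~ₚ? 1F) , ~-irrefl refl)
  agree 1F 2F = inj₁ (from-yes (1F ~ₚ? 2F) , bc)
  agree 1F 3F = inj₂ (from-no (1F ~ₚ? 3F) , b≁d)
  agree 2F 0F = inj₂ (from-no (2F ~ₚ? 0F) , a≁c ∘ ~-sym)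
  agree 2F 1F = inj₁ (from-yes (2F ~ₚ? 1F) , ~-sym bc)
  agree 2F 2F = inj₂ (from-no (2F ~ₚ? 2F) , ~-irrefl refl)
  agree 2F 3F = inj₁ (from-yes (2F ~ₚ? 3F) , cd)
  agree 3F 0F = inj₂ (from-no (3F ~ₚ? 0F) , a≁d ∘ ~-sym)
  agree 3F 1F = inj₂ (from-no (3F ~ₚ? 1F) , b≁d ∘ ~-sym)
  agree 3F 2F = inj₁ (from-yes (3F ~ₚ? 2F) , ~-sym cd)
  agree 3F 3F = inj₂ (from-no (3F ~ₚ? 3F) , ~-irrefl refl)
  a≢c : a ≢ c
  a≢c refl = a≁d cd
  b≢d : b ≢ d
  b≢d refl = a≁d ab
  a≢d : a ≢ d
  a≢d refl = b≁d (~-sym ab)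
  distinct : ∀ {x y} → x ~ y → x ≢ y
  distinct x~y x≡y = ~-irrefl x≡y x~y
  injective : ∀ x y → to x ≡ to y → x ≡ y
  injective 0F 0F _ = refl
  injective 1F 1F _ = refl
  injective 2F 2F _ = refl
  injective 3F 3F _ = refl
  injective 0F 1F e = contradiction e (distinct ab)
  injective 0F 2F e = contradiction e a≢c
  injective 0F 3F e = contradiction e a≢d
  injective 1F 0F e = contradiction (sym e) (distinct ab)
  injective 1F 2F e = contradiction e (distinct bc)
  injective 1F 3F e = contradiction e b≢d
  injective 2F 0F e = contradiction (sym e) a≢c
  injective 2F 1F e = contradiction (sym e) (distinct bc)
  injective 2F 3F e = contradiction e (distinct cd)
  injective 3F 0F e = contradiction (sym e) a≢d
  injective 3F 1F e = contradiction (sym e) b≢d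
  injective 3F 2F e = contradiction (sym e) (distinct cd)

-- If a - b - c - d is an induced path of the complement, then c - a - d - b is one of G.
complement-P₄-free : (G : Graph n) → P₄-Free G → P₄-Free (complement G)
complement-P₄-free G free {a} {b} {c} {d} ab@(a≢b , a≁b) bc@(_ , b≁c) cd@(_ , c≁d) ¬ac ¬ad ¬bd =
  free (~-sym (adjacent a≢c ¬ac)) (adjacent a≢d ¬ad) (~-sym (adjacent b≢d ¬bd))
       c≁d (b≁c ∘ ~-sym) a≁b
  where
  open Graph G
  module Gᶜ = Graph (complement G)
  adjacent : ∀ {x y} → x ≢ y → ¬ (x Gᶜ.~ y) → x ~ y
  adjacent {x} {y} x≢y ¬xy = decidable-stable (x ~? y) (λ x≁y → ¬xy (x≢y , x≁y))
  a≢c : a ≢ c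
  a≢c refl = ¬ad cd
  b≢d : b ≢ d
  b≢d refl = ¬ad ab
  a≢d : a ≢ d
  a≢d refl = ¬bd (Gᶜ.~-sym ab)

-- A split of U in `complement G` expresses U as a join in G, so this one notion covers both cotree
-- operations.
record Split (G : Graph n) (U : Subset n) : Set₁ where
  open Graph G
  field
    Side      : Pred (Fin n) 0ℓ
    side?     : Decidable Side
    one       : ∃[ x ] x ∈ U × Side x
    other     : ∃[ x ] x ∈ U × ¬ Side x
    separated : ∀ {x y} → x ∈ U → y ∈ U → Side x → ¬ Side y → ¬ x ~ y

unsplit-complement² : (G : Graph n) {U : Subset n} → Split (complement (complement G)) U → Split G U
unsplit-complement² G s = record
  { Side = Side ; side? = side? ; one = one ; other = other
  ; separated = λ {x} {y} x∈ y∈ sx ¬sy x~y → separated x∈ y∈ sx ¬sy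
      ((λ { refl → ~-irrefl refl x~y }) , λ { (_ , x≁y) → x≁y x~y })
  }
  where
  open Graph G
  open Split s

x∈p-y⇒x≢y : ∀ {p : Subset n} {x y} → x ∈ p - y → x ≢ y
x∈p-y⇒x≢y {p = s ∷ p} {suc x} {zero}  _           ()
x∈p-y⇒x≢y {p = s ∷ p} {zero}  {zero}  ()
x∈p-y⇒x≢y {p = s ∷ p} {suc x} {suc y} (there x∈) refl = x∈p-y⇒x≢y {p = p} x∈ refl

-- Let C be the component in U - v of a vertex w not adjacent to v. If v has neighbours both inside
-- and outside C, then a walk inside C from w to a neighbour of v has an edge a - b with v adjacent
-- to b only, and a - b - v - z is an induced path for every neighbour z of v outside C.
module Extend (G : Graph n) (free : P₄-Free G) {U : Subset n} {v : Fin n} (v∈U : v ∈ U)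
              (s : Split G (U - v)) where
  open Graph G
  open Split s

  U′ : Subset n
  U′ = U - v

  U′⊆U : U′ ⊆ U
  U′⊆U = p─q⊆p U ⁅ v ⁆

  ∈U′ : ∀ {x} → x ∈ U → x ≢ v → x ∈ U′
  ∈U′ = x∈p∧x≢y⇒x∈p-y

  module _ {w : Fin n} (w∈U′ : w ∈ U′) (v≁w : ¬ v ~ w) where

    C : Pred (Fin n) 0ℓ
    C = Star (StepIn G U′) w

    C? : Decidable C
    C? = Reachability.star? (StepIn G U′) (λ x y → (x ∈? U′) ×-dec ((y ∈? U′) ×-dec (x ~? y))) w

    C⊆U′ : ∀ {x} → C x → x ∈ U′
    C⊆U′ = end w∈U′
      where
      end : ∀ {x y} → x ∈ U′ → Star (StepIn G U′) x y → y ∈ U′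
      end x∈ ε                 = x∈
      end _  ((_ , y∈ , _) ◅ r) = end y∈ r

    C-closed : ∀ {x y} → C x → y ∈ U′ → x ~ y → C y
    C-closed cx y∈ x~y = cx ◅◅ (C⊆U′ cx , y∈ , x~y) ◅ ε

    v∉C : ¬ C v
    v∉C cv = x∈p-y⇒x≢y {p = U} (C⊆U′ cv) refl

    C-side : ∀ {x} → Side w → C x → Side x
    C-side = go
      where
      go : ∀ {x y} → Side x → Star (StepIn G U′) x y → Side y
      go sx ε = sx
      go sx (_◅_ {j = y} (x∈ , y∈ , x~y) r) =
        go (decidable-stable (side? y) (λ ¬sy → separated x∈ y∈ sx ¬sy x~y)) r

    C-other : ∀ {x} → ¬ Side w → C x → ¬ Side x
    C-other = go
      where
      go : ∀ {x y} → ¬ Side x → Star (StepIn G U′) x y → ¬ Side y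
      go ¬sx ε = ¬sx
      go ¬sx ((x∈ , y∈ , x~y) ◅ r) = go (λ sy → separated y∈ x∈ sy ¬sx (~-sym x~y)) r

    outside-C : ∃[ y ] y ∈ U′ × ¬ C y
    outside-C with side? w | one | other
    ... | yes sw | _ | y , y∈ , ¬sy = y , y∈ , λ cy → ¬sy (C-side sw cy)
    ... | no ¬sw | y , y∈ , sy | _  = y , y∈ , λ cy → C-other ¬sw cy sy

    last-nonneighbour : ∀ {x y} → C x → ¬ v ~ x → v ~ y → Star (StepIn G U′) x y →
      ∃[ a ] ∃[ b ] C a × C b × a ~ b × ¬ v ~ a × v ~ b
    last-nonneighbour cx v≁x v~y ε = contradiction v~y v≁x
    last-nonneighbour cx v≁x v~y (_◅_ {j = z} (x∈ , z∈ , x~z) r) with v ~? z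
    ... | yes v~z = _ , z , cx , C-closed cx z∈ x~z , x~z , v≁x , v~z
    ... | no  v≁z = last-nonneighbour (C-closed cx z∈ x~z) v≁z v~y r

    split : Split G U
    split with Fin.any? (λ z → (z ∈? U′) ×-dec (¬? (C? z) ×-dec (v ~? z)))
    -- All neighbours of v lie in C, so v goes to the side of C. The old split still supplies a
    -- vertex outside C, because C stays on one of its sides.
    ... | no none = record
      { Side  = λ x → C x ⊎ x ≡ v
      ; side? = λ x → C? x ⊎-dec (x Fin.≟ v)
      ; one   = w , U′⊆U w∈U′ , inj₁ ε
      ; other = let (y , y∈ , ¬cy) = outside-C in
          y , U′⊆U y∈ , λ { (inj₁ cy) → ¬cy cy ; (inj₂ y≡v) → x∈p-y⇒x≢y {p = U} y∈ y≡v }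
      ; separated = λ
          { _ y∈ (inj₁ cx)  ¬sy x~y → ¬sy (inj₁ (C-closed cx (∈U′ y∈ (¬sy ∘ inj₂)) x~y))
          ; _ y∈ (inj₂ refl) ¬sy v~y → none (_ , ∈U′ y∈ (¬sy ∘ inj₂) , ¬sy ∘ inj₁ , v~y)
          }
      }
    ... | yes (z , z∈ , ¬cz , v~z) with Fin.any? (λ x → C? x ×-dec (v ~? x))
    -- No neighbour of v lies in C, so C alone is separated from the rest, including v.
    ...   | no none = record
      { Side  = C
      ; side? = C?
      ; one   = w , U′⊆U w∈U′ , ε
      ; other = v , v∈U , v∉C
      ; separated = apart
      }
      where
      apart : ∀ {x y} → x ∈ U → y ∈ U → C x → ¬ C y → ¬ x ~ y
      apart {x} {y} _ y∈ cx ¬cy x~y with y Fin.≟ v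
      ... | yes refl = none (x , cx , ~-sym x~y)
      ... | no  y≢v  = ¬cy (C-closed cx (∈U′ y∈ y≢v) x~y)
    ...   | yes (x , cx , v~x) with last-nonneighbour ε v≁w v~x cx
    ...     | a , b , ca , cb , a~b , v≁a , v~b = ⊥-elim
      (free a~b (~-sym v~b) v~z (v≁a ∘ ~-sym) (¬cz ∘ C-closed ca z∈) (¬cz ∘ C-closed cb z∈))

  extend : Split G U ⊎ Split (complement G) U
  extend with Fin.any? (λ w → (w ∈? U′) ×-dec ¬? (v ~? w))
  ... | yes (w , w∈ , v≁w) = inj₁ (split w∈ v≁w)
  -- Here v is adjacent to everything else in U, hence isolated in the complement.
  ... | no none = inj₂ record
    { Side  = _≡ v
    ; side? = Fin._≟ v
    ; one   = v , v∈U , refl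
    ; other = let (y , y∈ , _) = one in y , U′⊆U y∈ , x∈p-y⇒x≢y {p = U} y∈
    ; separated = λ { {_} {y} _ y∈ refl y≢v (_ , v≁y) → none (y , ∈U′ y∈ y≢v , v≁y) }
    }

-- Induction by deleting v. If a third vertex exists, what is left still has two vertices and splits
-- in G or in its complement; `Extend` applies to either graph, both being free of P₄. Without a
-- third vertex, adjacency of v and w decides. The bound k serves termination.
split-P₄-free : ∀ k (G : Graph n) → P₄-Free G → ∀ {U v w} → ∣ U ∣ ≤ k → v ∈ U → w ∈ U → w ≢ v →
  Split G U ⊎ Split (complement G) U
split-P₄-free zero G free {U} le v∈ _ _ = contradiction 0<∣ _ , v∈ ∣ (≤⇒≯ le)
split-P₄-free (suc k) G free {U} {v} {w} le v∈ w∈ w≢v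
  with Fin.any? (λ u → (u ∈? (U - v)) ×-dec ¬? (u Fin.≟ w))
... | yes (u , u∈ , u≢w)
    with split-P₄-free k G free (≤-pred (≤-trans (x∈p⇒∣p-x∣<∣p∣ v∈) le)) (x∈p∧x≢y⇒x∈p-y w∈ w≢v) u∈ u≢w
...   | inj₁ s = Extend.extend G free v∈ s
...   | inj₂ s with Extend.extend (complement G) (complement-P₄-free G free) v∈ s
...     | inj₁ t = inj₂ t
...     | inj₂ t = inj₁ (unsplit-complement² G t)
split-P₄-free (suc k) G free {U} {v} {w} le v∈ w∈ w≢v | no none = pair (v ~? w)
  where
  open Graph G
  pair : Dec (v ~ w) → Split G U ⊎ Split (complement G) U
  only : ∀ {y} → y ∈ U → y ≢ v → y ≡ w
  only {y} y∈ y≢v =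
    decidable-stable (y Fin.≟ w) (λ y≢w → none (y , x∈p∧x≢y⇒x∈p-y y∈ y≢v , y≢w))
  pair (yes v~w) = inj₂ record
    { Side = _≡ v ; side? = Fin._≟ v ; one = v , v∈ , refl ; other = w , w∈ , w≢v
    ; separated = λ { _ y∈ refl y≢v (_ , v≁y) → v≁y (subst (v ~_) (sym (only y∈ y≢v)) v~w) }
    }
  pair (no v≁w) = inj₁ record
    { Side = _≡ v ; side? = Fin._≟ v ; one = v , v∈ , refl ; other = w , w∈ , w≢v
    ; separated = λ { _ y∈ refl y≢v v~y → v≁w (subst (v ~_) (only y∈ y≢v) v~y) }
    }

partition : (U : Subset n) {P : Pred (Fin n) 0ℓ} → Decidable P →
  ∃[ A ] ∃[ B ] Partition U A B × (∀ {x} → x ∈ A → P x) × (∀ {x} → x ∈ B → ¬ P x)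
partition [] P? = [] , [] , [] , (λ ()) , (λ ())
partition (outside ∷ U) P? with partition U (P? ∘ suc)
... | A , B , p , inA , inB = outside ∷ A , outside ∷ B , neither p ,
  (λ { (there x∈) → inA x∈ }) , (λ { (there x∈) → inB x∈ })
partition (inside ∷ U) P? with partition U (P? ∘ suc) | P? zero
... | A , B , p , inA , inB | yes q = inside ∷ A , outside ∷ B , left p ,
  (λ { here → q ; (there x∈) → inA x∈ }) , (λ { (there x∈) → inB x∈ })
... | A , B , p , inA , inB | no ¬q = outside ∷ A , inside ∷ B , right p ,
  (λ { (there x∈) → inA x∈ }) , (λ { here → ¬q ; (there x∈) → inB x∈ })

∈-Partition : {U A B : Subset n} → Partition U A B → ∀ {x} → x ∈ U → x ∈ A ⊎ x ∈ B
∈-Partition (left p)  here       = inj₁ here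
∈-Partition (right p) here       = inj₂ here
∈-Partition (left p)  (there x∈) with ∈-Partition p x∈
... | inj₁ x∈A = inj₁ (there x∈A)
... | inj₂ x∈B = inj₂ (there x∈B)
∈-Partition (right p) (there x∈) with ∈-Partition p x∈
... | inj₁ x∈A = inj₁ (there x∈A)
... | inj₂ x∈B = inj₂ (there x∈B)
∈-Partition (neither p)  (there x∈) with ∈-Partition p x∈
... | inj₁ x∈A = inj₁ (there x∈A)
... | inj₂ x∈B = inj₂ (there x∈B)

∪≡-Partition : {U A B : Subset n} → Partition U A B → A ∪ˢ B ≡ U
∪≡-Partition []        = refl
∪≡-Partition (left p)  = cong (inside ∷_) (∪≡-Partition p)
∪≡-Partition (right p) = cong (inside ∷_) (∪≡-Partition p)
∪≡-Partition (neither p)  = cong (outside ∷_) (∪≡-Partition p)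

≡⁅⁆ : {U : Subset n} {v : Fin n} → v ∈ U → (∀ {x} → x ∈ U → x ≡ v) → U ≡ ⁅ v ⁆
≡⁅⁆ {v = v} v∈ only = ⊆-antisym
  (λ x∈ → subst (_∈ ⁅ v ⁆) (sym (only x∈)) (x∈⁅x⁆ v))
  (λ x∈ → subst (_∈ _) (sym (x∈⁅y⁆⇒x≡y v x∈)) v∈)

decompose : ∀ k (G : Graph n) → P₄-Free G → (U : Subset n) → ∣ U ∣ ≤ k → Nonempty U →
  ∃ (Decomposes G U)
decompose zero    G free U le ne = contradiction 0<∣ ne ∣ (≤⇒≯ le)
decompose {n} (suc k) G free U le (v , v∈) with Fin.any? (λ w → (w ∈? U) ×-dec ¬? (w Fin.≟ v))
... | no none = leaf , subst (λ U → Decomposes G U leaf) (sym (≡⁅⁆ v∈ only)) (leaf v)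
  where
  only : ∀ {x} → x ∈ U → x ≡ v
  only {x} x∈ = decidable-stable (x Fin.≟ v) (λ x≢v → none (x , x∈ , x≢v))
... | yes (w , w∈ , w≢v) = by-split (split-P₄-free (suc k) G free le v∈ w∈ w≢v)
  where
  -- H is G or its complement, but the two parts are decomposed in G in either case.
  module Parts {H : Graph n} (s : Split H U) where
    open Split s
    parts = partition U side?
    A = proj₁ parts
    B = proj₁ (proj₂ parts)
    p : Partition U A B
    p = proj₁ (proj₂ (proj₂ parts))
    inA : ∀ {x} → x ∈ A → Side x
    inA = proj₁ (proj₂ (proj₂ (proj₂ parts)))
    inB : ∀ {x} → x ∈ B → ¬ Side x
    inB = proj₂ (proj₂ (proj₂ (proj₂ parts)))
    A⊆U : A ⊆ U
    A⊆U {x} x∈ = subst (x ∈_) (∪≡-Partition p) (p⊆p∪q B x∈)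
    B⊆U : B ⊆ U
    B⊆U {x} x∈ = subst (x ∈_) (∪≡-Partition p) (q⊆p∪q A B x∈)
    nonemptyA : Nonempty A
    nonemptyA with (x , x∈ , sx) ← one with ∈-Partition p x∈
    ... | inj₁ x∈A = x , x∈A
    ... | inj₂ x∈B = contradiction sx (inB x∈B)
    nonemptyB : Nonempty B
    nonemptyB with (x , x∈ , ¬sx) ← other with ∈-Partition p x∈
    ... | inj₁ x∈A = contradiction (inA x∈A) ¬sx
    ... | inj₂ x∈B = x , x∈B
    decomposeA : ∃ (Decomposes G A)
    decomposeA = decompose k G free A (≤-pred (≤-trans (≤-trans
      (m<m+n ∣ A ∣ 0<∣ nonemptyB ∣) (≤-reflexive (sym (∣∣-Partition p)))) le)) nonemptyA
    decomposeB : ∃ (Decomposes G B)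
    decomposeB = decompose k G free B (≤-pred (≤-trans (≤-trans
      (m<n+m ∣ B ∣ 0<∣ nonemptyA ∣) (≤-reflexive (sym (∣∣-Partition p)))) le)) nonemptyB
    apart : ∀ {x y} → x ∈ A → y ∈ B → ¬ Graph._~_ H x y
    apart x∈ y∈ = separated (A⊆U x∈) (B⊆U y∈) (inA x∈) (inB y∈)

  by-split : Split G U ⊎ Split (complement G) U → ∃ (Decomposes G U)
  by-split (inj₁ s) = _ , union p apart (proj₂ decomposeA) (proj₂ decomposeB)
    where open Parts s
  by-split (inj₂ s) = _ , join p full (proj₂ decomposeA) (proj₂ decomposeB)
    where
    open Parts s
    full : FullyJoined G A B
    full {x} {y} x∈ y∈ = decidable-stable (Graph._~?_ G x y)
      (λ x≁y → apart x∈ y∈ ((λ { refl → disjoint p x∈ y∈ }) , x≁y))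

-- Graphs and their means

Decomposes⇒Nonempty : {G : Graph n} → ∀ {U a} → Decomposes G U a → Nonempty U
Decomposes⇒Nonempty (leaf x)        = x , x∈⁅x⁆ x
Decomposes⇒Nonempty (union {B = B} p _ d _) with x , x∈A ← Decomposes⇒Nonempty d =
  x , subst (x ∈_) (∪≡-Partition p) (p⊆p∪q B x∈A)
Decomposes⇒Nonempty (join {B = B} p _ d _)  with x , x∈A ← Decomposes⇒Nonempty d =
  x , subst (x ∈_) (∪≡-Partition p) (p⊆p∪q B x∈A)

join⇒connected : (G : Graph n) → ∀ {U a b} → Decomposes G U (a ⊗ b) → InducesConnected G U
join⇒connected G (join p full d e) = subst (InducesConnected G) (∪≡-Partition p)
  (fullyJoined⇒connected G full (Decomposes⇒Nonempty d) (Decomposes⇒Nonempty e))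

union⇒¬connected : (G : Graph n) → ∀ {U a b} → Decomposes G U (a ⊕ b) → ¬ InducesConnected G U
union⇒¬connected G (union p anti d e) conn =
  anticomplete⇒¬connected G p anti ⊆-refl ⊆-refl (Decomposes⇒Nonempty d) (Decomposes⇒Nonempty e)
    (subst (InducesConnected G) (sym (∪≡-Partition p)) conn)

disconnected⇒union : (G : Graph n) → ∀ {U c} → Decomposes G U c → ¬ InducesConnected G U →
  ∃[ a ] ∃[ b ] c ≡ a ⊕ b
disconnected⇒union G (leaf x)        ¬conn = contradiction (singleton-connected G x) ¬conn
disconnected⇒union G (union _ _ _ _) ¬conn = _ , _ , refl
disconnected⇒union G d@(join _ _ _ _) ¬conn = contradiction (join⇒connected G d) ¬conn

cotree : (G : Graph (suc n)) → Cograph G → ∃ (Decomposes G ⊤)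
cotree {n} G cograph =
  decompose (suc n) G (cograph⇒P₄-free G cograph) ⊤ (∣p∣≤n {suc n} ⊤) (zero , ∈⊤)

order-⊤ : {G : Graph n} → ∀ {a} → Decomposes G ⊤ a → order a ≡ n
order-⊤ {n} {G} d = trans (sym (∣∣-Decomposes G d)) (∣⊤∣≡n n)

⊤-rightPartition : ∀ n → Partition (⊤ {n}) ⊥ ⊤
⊤-rightPartition zero    = []
⊤-rightPartition (suc n) = right (⊤-rightPartition n)

-- On vertices `suc x` the `splitAt 1` in the union computes, so adjacency in Q carries over under
-- `inj₂`.
K₁∪-Decomposes : {Q : Graph n} → ∀ {U a} → Decomposes Q U a → Decomposes (K₁ ∪ Q) (outside ∷ U) a
K₁∪-Decomposes (leaf x)           = leaf (suc x)
K₁∪-Decomposes (union p anti d e) = union (neither p)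
  (λ { (there x∈) (there y∈) (inj₂ x~y) → anti x∈ y∈ x~y }) (K₁∪-Decomposes d) (K₁∪-Decomposes e)
K₁∪-Decomposes (join p full d e)  = join (neither p)
  (λ { (there x∈) (there y∈) → inj₂ (full x∈ y∈) }) (K₁∪-Decomposes d) (K₁∪-Decomposes e)

K₁∪-Decomposes-⊤ : {Q : Graph n} → ∀ {a} → Decomposes Q ⊤ a → Decomposes (K₁ ∪ Q) ⊤ (leaf ⊕ a)
K₁∪-Decomposes-⊤ {n} {Q} d =
  union {A = ⁅ zero ⁆} (left (⊤-rightPartition n)) anti (leaf zero) (K₁∪-Decomposes d)
  where
  anti : Anticomplete (K₁ ∪ Q) ⁅ zero ⁆ (outside ∷ ⊤)
  anti here       (there _) ()
  anti (there x∈) _         = contradiction x∈ ∉⊥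

-- Since `_/_` reduces fractions, cross multiplication goes through unnormalised rationals.
/-≤-/⁺ : ∀ p q s t .{{_ : NonZero s}} .{{_ : NonZero t}} → p * t ≤ q * s →
  (ℤ.+ p / s) ≤ℚ (ℤ.+ q / t)
/-≤-/⁺ p q (suc s) (suc t) le = ℚ.toℚᵘ-cancel-≤
  (ℚᵘ.≤-respˡ-≃ (ℚᵘ.≃-sym (ℚ.toℚᵘ-fromℚᵘ (mkℚᵘ (ℤ.+ p) s)))
    (ℚᵘ.≤-respʳ-≃ (ℚᵘ.≃-sym (ℚ.toℚᵘ-fromℚᵘ (mkℚᵘ (ℤ.+ q) t)))
      (*≤* (subst₂ ℤ._≤_ (ℤ.pos-* p (suc t)) (ℤ.pos-* q (suc s)) (+≤+ le)))))

/-≤-/⁻ : ∀ p q s t .{{_ : NonZero s}} .{{_ : NonZero t}} → (ℤ.+ p / s) ≤ℚ (ℤ.+ q / t) →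
  p * t ≤ q * s
/-≤-/⁻ p q (suc s) (suc t) le = ℤ.drop‿+≤+
  (subst₂ ℤ._≤_ (sym (ℤ.pos-* p (suc t))) (sym (ℤ.pos-* q (suc s)))
    (ℚᵘ.drop-*≤*
      (ℚᵘ.≤-respˡ-≃ (ℚ.toℚᵘ-fromℚᵘ (mkℚᵘ (ℤ.+ p) s))
        (ℚᵘ.≤-respʳ-≃ (ℚ.toℚᵘ-fromℚᵘ (mkℚᵘ (ℤ.+ q) t)) (ℚ.toℚᵘ-mono-≤ le)))))

module _ (G : Graph m) (H : Graph n) .{{_ : NonZero m}} .{{_ : NonZero n}} {a b : Cotree}
         (d : Decomposes G ⊤ a) (e : Decomposes H ⊤ b) where

  private
    S S′ W W′ : ℕ
    S  = eval (Φ G) 1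
    S′ = eval (Φ H) 1
    W  = eval (derivative (Φ G)) 1
    W′ = eval (derivative (Φ H)) 1

    mean≡ : (W * S′ ≤ W′ * S) ≡ (a ≼ b)
    mean≡ = cong₂ _≤_
      (cong₂ _*_ (trans (Φ′[1] G) (sizeSum-Decomposes G d)) (trans (Φ[1] H) (count-Decomposes H e)))
      (cong₂ _*_ (trans (Φ′[1] H) (sizeSum-Decomposes H e)) (trans (Φ[1] G) (count-Decomposes G d)))

  ≼⇒globalMean≤ : a ≼ b → globalMean G ≤ℚ globalMean H
  ≼⇒globalMean≤ le = /-≤-/⁺ W W′ S S′ {{Φ[1]-nonZero G}} {{Φ[1]-nonZero H}}
    (subst id (sym mean≡) le)

  globalMean≤⇒≼ : globalMean G ≤ℚ globalMean H → a ≼ b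
  globalMean≤⇒≼ le = subst id mean≡
    (/-≤-/⁻ W W′ S S′ {{Φ[1]-nonZero G}} {{Φ[1]-nonZero H}} le)

-- Explicit competitors of Q and their cotrees

edgeless-Decomposes : (G : Graph n) → ∀ k {U} → ∣ U ∣ ≡ suc k → Anticomplete G U U →
  Decomposes G U (edgeless k)
edgeless-Decomposes {n} G k {U} size anti with ⊥-or-Nonempty U
... | inj₁ refl with () ← trans (sym size) (∣⊥∣≡0 n)
... | inj₂ (v , v∈) with partition U (Fin._≟ v)
...   | A , B , p , inA , inB = build k size
  where
  v∈A : v ∈ A
  v∈A with ∈-Partition p v∈
  ... | inj₁ v∈A = v∈A
  ... | inj₂ v∈B = contradiction refl (inB v∈B)
  A≡ : A ≡ ⁅ v ⁆
  A≡ = ≡⁅⁆ v∈A inA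
  A⊆U : A ⊆ U
  A⊆U {x} x∈ = subst (x ∈_) (∪≡-Partition p) (p⊆p∪q B x∈)
  B⊆U : B ⊆ U
  B⊆U {x} x∈ = subst (x ∈_) (∪≡-Partition p) (q⊆p∪q A B x∈)
  size-B : ∀ {k} → ∣ U ∣ ≡ suc k → ∣ B ∣ ≡ k
  size-B {k} size = suc-injective (trans (sym (cong (_+ ∣ B ∣) (trans (cong ∣_∣ A≡) (∣⁅x⁆∣≡1 v))))
                      (trans (sym (∣∣-Partition p)) size))
  build : ∀ k → ∣ U ∣ ≡ suc k → Decomposes G U (edgeless k)
  build zero    size = subst (λ U → Decomposes G U leaf) (sym (≡⁅⁆ v∈ only)) (leaf v)
    where
    only : ∀ {x} → x ∈ U → x ≡ v
    only x∈ with ∈-Partition p x∈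
    ... | inj₁ x∈A = inA x∈A
    ... | inj₂ x∈B = contradiction (size-B size) (λ ∣B∣≡0 → n≮0 (subst (0 <_) ∣B∣≡0 0<∣ _ , x∈B ∣))
  build (suc k) size = union p (λ x∈ y∈ → anti (A⊆U x∈) (B⊆U y∈))
    (subst (λ A → Decomposes G A leaf) (sym A≡) (leaf v))
    (edgeless-Decomposes G k (size-B size) (λ x∈ y∈ → anti (B⊆U x∈) (B⊆U y∈)))

completeBipartite : Subset n → Graph n
completeBipartite A = record
  { _~_      = λ x y → lookup A x ≢ lookup A y
  ; _~?_     = λ x y → ¬? (lookup A x ≟ᵇ lookup A y)
  ; ~-sym    = λ x≁y → x≁y ∘ sym
  ; ~-irrefl = λ { refl x~x → x~x refl }
  }

-- Sides alternate along a path, so the ends of a path on four vertices lie on opposite sides and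
-- are adjacent.
completeBipartite-cograph : (A : Subset n) → Cograph (completeBipartite A)
completeBipartite-cograph A e = 0≁3 (adj 0F 3F .from λ eq → adj 2F 3F .to (inj₁ refl)
    (trans (sym (skip (adj 0F 1F .to (inj₁ refl)) (adj 1F 2F .to (inj₁ refl)))) eq))
  where
  open InducedEmbedding e renaming (to to ι; adjacency to adj)
  open Equivalence using (to; from)
  0≁3 : ¬ Graph._~_ (path 4) 0F 3F
  0≁3 = from-no (Graph._~?_ (path 4) 0F 3F)
  skip : ∀ {x y z : Bool} → x ≢ y → y ≢ z → x ≡ z
  skip {z = z} x≢y y≢z = trans (¬-not x≢y) (trans (cong not (¬-not y≢z)) (not-involutive z))

∁-Partition : (A : Subset n) → Partition ⊤ A (∁ A)
∁-Partition []            = []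
∁-Partition (inside  ∷ A) = left (∁-Partition A)
∁-Partition (outside ∷ A) = right (∁-Partition A)

completeBipartite-Decomposes : (A : Subset n) → ∀ {s t} → ∣ A ∣ ≡ suc s → ∣ ∁ A ∣ ≡ suc t →
  Decomposes (completeBipartite A) ⊤ (edgeless s ⊗ edgeless t)
completeBipartite-Decomposes A {s} {t} size size′ = join (∁-Partition A)
  (λ x∈ y∈ eq → x∈∁p⇒x∉p y∈ (lookup⇒[]= _ A (trans (sym eq) ([]=⇒lookup x∈))))
  (edgeless-Decomposes G s size (λ x∈ y∈ x~y → x~y (trans ([]=⇒lookup x∈) (sym ([]=⇒lookup y∈)))))
  (edgeless-Decomposes G t size′ (λ x∈ y∈ x~y → x~y (trans (out x∈) (sym (out y∈)))))
  where
  G = completeBipartite A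
  out : ∀ {x} → x ∈ ∁ A → lookup A x ≡ outside
  out x∈ = ¬-not (λ eq → x∈∁p⇒x∉p x∈ (lookup⇒[]= _ A eq))

complete-cograph : ∀ n → Cograph (complete n)
complete-cograph n e = from-no (Graph._~?_ (path 4) 0F 2F)
  (Equivalence.from (adjacency 0F 2F) λ eq → contradiction (injective eq) λ ())
  where open InducedEmbedding e

complete₃-Decomposes : Decomposes (complete 3) ⊤ (leaf ⊗ (leaf ⊗ leaf))
complete₃-Decomposes =
  join p (distinct p) (leaf 0F) (join q (distinct q) (leaf 1F) (leaf 2F))
  where
  p : Partition ⊤ ⁅ 0F ⁆ (outside ∷ inside ∷ inside ∷ [])
  p = left (right (right []))
  q : Partition (outside ∷ inside ∷ inside ∷ []) ⁅ 1F ⁆ ⁅ 2F ⁆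
  q = neither (left (right []))
  distinct : ∀ {U A B} → Partition U A B → FullyJoined (complete 3) A B
  distinct p x∈ y∈ refl = disjoint p x∈ y∈

-- Consequences of the maximality of Q

module _ {n : ℕ} .{{_ : NonZero n}} (Q : Graph n) (max : IsMaxMeanConnectedCograph Q)
         {q : Cotree} (d : Decomposes Q ⊤ q) where
  open IsMaxMeanConnectedCograph max using (maximum)

  ≼-max : (H : Graph n) → ∀ {a b} → Cograph H → Decomposes H ⊤ (a ⊗ b) → (a ⊗ b) ≼ q
  ≼-max H cograph e = globalMean≤⇒≼ H Q e d (maximum H (join⇒connected H e) cograph)

  completeBipartite≼ : (A : Subset n) → ∀ {s t} → ∣ A ∣ ≡ suc s → ∣ ∁ A ∣ ≡ suc t →
    (edgeless s ⊗ edgeless t) ≼ q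
  completeBipartite≼ A size size′ =
    ≼-max (completeBipartite A) (completeBipartite-cograph A) (completeBipartite-Decomposes A size size′)

  star≼ : ∀ k → n ≡ 7 + k → star (5 + k) ≼ q
  -- `edgeless 0` is `leaf`, so the cotree with sides of orders 1 and 6 + k is the star.
  star≼ k refl = completeBipartite≼ ⁅ zero ⁆ (∣⁅x⁆∣≡1 {7 + k} zero)
    (trans (∣∁p∣≡n∸∣p∣ {7 + k} ⁅ zero ⁆) (cong (7 + k ∸_) (∣⁅x⁆∣≡1 {7 + k} zero)))

-- The explicit cotrees have profiles that evaluate to `best m`, so each comparison of means with Q
-- already has the required type.
best≼ᵖ : ∀ m .{{_ : NonZero m}} → m ≤ 6 → (Q : Graph m) → IsMaxMeanConnectedCograph Q →
  ∀ {q} → Decomposes Q ⊤ q → best m ≼ᵖ profile q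
best≼ᵖ 1 _ Q max {q} d = globalMean≤⇒≼ (complete 1) Q (leaf 0F) d
  (IsMaxMeanConnectedCograph.maximum max (complete 1)
    (singleton-connected (complete 1) 0F) (complete-cograph 1))
best≼ᵖ 2 _ Q max d = completeBipartite≼ Q max d (inside ∷ outside ∷ []) refl refl
best≼ᵖ 3 _ Q max d = ≼-max Q max d (complete 3) (complete-cograph 3) complete₃-Decomposes
best≼ᵖ 4 _ Q max d = completeBipartite≼ Q max d (inside ∷ inside ∷ outside ∷ outside ∷ []) refl refl
best≼ᵖ 5 _ Q max d =
  completeBipartite≼ Q max d (inside ∷ inside ∷ outside ∷ outside ∷ outside ∷ []) refl refl
best≼ᵖ 6 _ Q max d = completeBipartite≼ Q max d
  (inside ∷ inside ∷ outside ∷ outside ∷ outside ∷ outside ∷ []) refl refl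
best≼ᵖ (suc (suc (suc (suc (suc (suc (suc m))))))) (s≤s (s≤s (s≤s (s≤s (s≤s (s≤s ()))))))

connected⇒join : (G : Graph n) → ∀ {U c} → 2 ≤ order c → Decomposes G U c → InducesConnected G U →
  ∃[ a ] ∃[ b ] c ≡ a ⊗ b
connected⇒join G (s≤s ()) (leaf x)
connected⇒join G _ d@(union _ _ _ _) conn = contradiction conn (union⇒¬connected G d)
connected⇒join G _ (join _ _ _ _)    conn = _ , _ , refl

theorem5p3 : ∀ (m : ℕ) .{{_ : NonZero m}} (Q : Graph m) → IsMaxMeanConnectedCograph Q →
    ∀ (G : Graph (suc m)) → Disconnected G → Cograph G →
    globalMean G ≤ℚ globalMean (K₁ ∪ Q)
theorem5p3 m@(suc m-1) Q max G disconnected cograph =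
  compare (proj₂ (cotree G cograph)) (proj₂ (cotree Q (IsMaxMeanConnectedCograph.cograph max)))
  where
  bound : ∀ {a b q} → Decomposes G ⊤ (a ⊕ b) → Decomposes Q ⊤ q → Dec (m ≤ 6) →
    (a ⊕ b) ≼ (leaf ⊕ q)
  bound {a} {b} {q} dg dq (yes m≤6) =
    small-order m a b q m≤6 (order-⊤ dg) (order-⊤ dq) (best≼ᵖ m m≤6 Q max dq)
  bound {a} {b} dg dq (no m≰6) = large
    (connected⇒join Q (subst (2 ≤_) (sym (order-⊤ dq)) (≤-trans (s≤s (s≤s z≤n)) (≰⇒> m≰6))) dq
      (IsMaxMeanConnectedCograph.connected max))
    dq
    where
    k = m ∸ 7
    m≡ : m ≡ 7 + k
    m≡ = sym (m+[n∸m]≡n (≰⇒> m≰6))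
    large : ∀ {q} → ∃[ c ] ∃[ d ] q ≡ c ⊗ d → Decomposes Q ⊤ q → (a ⊕ b) ≼ (leaf ⊕ q)
    large (c , d , refl) dq =
      large-order k a b c d (trans (order-⊤ dg) (cong suc m≡)) (trans (order-⊤ dq) m≡)
        (star≼ Q max dq k m≡)
  compare : ∀ {g q} → Decomposes G ⊤ g → Decomposes Q ⊤ q →
    globalMean G ≤ℚ globalMean (K₁ ∪ Q)
  compare {g} {q} dg dq = by-shape (disconnected⇒union G dg disconnected) dg
    where
    by-shape : ∀ {g} → ∃[ a ] ∃[ b ] g ≡ a ⊕ b → Decomposes G ⊤ g →
      globalMean G ≤ℚ globalMean (K₁ ∪ Q)
    by-shape (a , b , refl) dg =
      ≼⇒globalMean≤ G (K₁ ∪ Q) dg (K₁∪-Decomposes-⊤ dq) (bound dg dq (m ≤? 6))
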